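{- (i) For all integers $n,d$ with $d\equiv 8\pmod{10}$, $d\ge 8$, $n\ge 4d+6$ and $n\equiv 0\pmod{10}$, we have $\gamma^{LD}(C_n(1,d-1,d,d+1))=\frac n5$. (ii) There exist integers $n_k$, $d_k\ge 3$ with $d_k+1\le n_k/2$ and identifying codes $C_k$ in the circulant graphs $C_{n_k}(1,d_k-1,d_k,d_k+1)$ ($k=1,2,\dots$) such that $\lim_{k\to\infty}|C_k|/n_k=2/9$.
   Context: All graphs are simple and undirected. For a graph $G=(V,E)$ and $u\in V$, $N[u]=\{u\}\cup\{v: uv\in E\}$. A code is a nonempty $C\subseteq V$, and $I(C;u)=N[u]\cap C$. $C$ is dominating if $I(C;u)\neq\emptyset$ for all $u$; identifying if dominating and $I(C;u)\neq I(C;v)$ for all distinct $u,v\in V$; locating-dominating if dominating and $I(C;u)\neq I(C;v)$ for all distinct $u,v\in V\setminus C$. $\gamma^{LD}(G)$ denotes the minimum cardinality of a locating-dominating code in a finite graph $G$. For positive integers $n$ and $d_1,\dots,d_k\le n/2$, the circulant graph $C_n(d_1,\dots,d_k)$ has vertex set $\mathbb{Z}_n$, and the open neighbourhood of $u$ is $\{u\pm d_1,\dots,u\pm d_k\}$ modulo $n$. -}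

module Defs where

open import Data.Nat as ℕ using (ℕ; zero; suc; _≤_)
open import Data.Integer as ℤ using (ℤ; +_)
open import Data.Integer.Divisibility using (_∣_)
open import Data.Fin using (Fin; toℕ)
open import Data.Fin.Subset using (Subset; _∈_; _∉_; Nonempty; ∣_∣)
open import Data.List using (List)
open import Data.List.Relation.Unary.Any using (Any)
open import Data.Product using (_×_; ∃-syntax)
open import Data.Sum using (_⊎_)
open import Relation.Binary.PropositionalEquality using (_≡_; _≢_)
open import Relation.Nullary using (¬_)
open import Function.Bundles using (_⇔_)
open import Data.Rational as ℚ using (ℚ)

toℤ : ∀ {n} → Fin n → ℤ
toℤ u = + toℕ u

-- Adjacency in the circulant graph C_n(D), vertex set ℤ_n = Fin n:
-- u ≠ v and v ≡ u ± d (mod n) for some d ∈ D.  (Simple graph: no loops.)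
Adj : (n : ℕ) → List ℕ → Fin n → Fin n → Set
Adj n D u v = u ≢ v × Any (λ d → ((+ n) ∣ (toℤ v ℤ.- toℤ u ℤ.- + d))
                                ⊎ ((+ n) ∣ (toℤ v ℤ.- toℤ u ℤ.+ + d))) D

InN : (n : ℕ) → List ℕ → Fin n → Fin n → Set
InN n D u v = u ≡ v ⊎ Adj n D u v

InI : (n : ℕ) → List ℕ → Subset n → Fin n → Fin n → Set
InI n D C u c = InN n D u c × c ∈ C

SameI : (n : ℕ) → List ℕ → Subset n → Fin n → Fin n → Set
SameI n D C u v = ∀ c → InI n D C u c ⇔ InI n D C v c

Dominating : (n : ℕ) → List ℕ → Subset n → Set
Dominating n D C = ∀ u → ∃[ c ] InI n D C u c

Identifying : (n : ℕ) → List ℕ → Subset n → Set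
Identifying n D C = Nonempty C × Dominating n D C
  × (∀ u v → u ≢ v → ¬ SameI n D C u v)

LocatingDominating : (n : ℕ) → List ℕ → Subset n → Set
LocatingDominating n D C = Nonempty C × Dominating n D C
  × (∀ u v → u ∉ C → v ∉ C → u ≢ v → ¬ SameI n D C u v)

γLD≡ : (n : ℕ) → List ℕ → ℕ → Set
γLD≡ n D k = (∃[ C ] (LocatingDominating n D C × ∣ C ∣ ≡ k))
  × (∀ C → LocatingDominating n D C → k ≤ ∣ C ∣)

-- a / b as a rational (total: a / 0 := 0; only used with b > 0)
frac : ℕ → ℕ → ℚ
frac a zero = ℚ.0ℚ
frac a (suc m) = (+ a) ℚ./ suc m

{-# OPTIONS --safe #-}
module Submission where

-- Writing x + i + j d for the cell (i , j) of a window based at x identifies C_n(1,d-1,d,d+1) locally with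
-- the king grid, whose closed neighbourhoods are the 3×3 blocks.
--
-- Lower bound in (i).  Every dominating code satisfies
--   2 n ≤ Σ_u |I(u)| + #{u : |I(u)| = 1} − Σ_u (|I(u)| − 2)⁺.
-- A codeword contributes 9 to the first sum and at most 2 to the second (itself and one private
-- non-codeword), so it suffices that an isolated codeword with a private neighbour be refunded 1 from the
-- last sum, which makes the right-hand side at most 10 |C|.  The refunds follow a local rule (σ below), checked
-- on all 3×3 patterns and, by a pruned search, on all 5×5 windows.
--
-- The code of (i) is {x : x mod 10 ∈ {0, 4}}.  For (ii) take n = 6 d with 6 ∣ d and cut ℤ_n into 6 rows of
-- length d, each carrying the periodic king-grid code of density 2/9; since the end of a row is glued to the
-- start of the next one, the pattern is broken there, and this seam of 6 columns is filled with codewords.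
-- For both codes a vertex is recovered from the 7×7 window around it, and only finitely many windows occur.

open import Defs
open import Data.Nat using (ℕ; _+_; _*_; _∸_; _≤_; _≥_; _%_; _/_)
open import Data.Integer using (+_)
open import Data.Fin.Subset using (Subset; ∣_∣)
open import Data.List using (List; _∷_; [])
open import Data.Product using (Σ; _×_; ∃-syntax)
open import Relation.Binary.PropositionalEquality using (_≡_)
open import Data.Rational as ℚ using (ℚ)

open import Data.Bool.Base using (Bool; true; false; if_then_else_; not; _∧_; _∨_; T)
open import Data.Bool.ListAction using (any; all)
open import Data.Bool.Properties using (T-≡)
open import Data.Empty using (⊥; ⊥-elim)
open import Data.Fin.Base as Fin using (Fin; toℕ; fromℕ<)
open import Data.Fin.Properties using (toℕ-injective; toℕ<n; toℕ-fromℕ<) renaming (_≟_ to _≟ᶠ_)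
open import Data.Fin.Subset using (Nonempty) renaming (_∈_ to _∈ₛ_; _∉_ to _∉ₛ_)
open import Data.Integer.Base as ℤ using (ℤ; -[1+_])
import Data.Integer.Divisibility as ℤD
import Data.Integer.Divisibility.Signed as ℤS
import Data.Integer.Properties as ℤP
open import Data.Integer.Tactic.RingSolver using () renaming (solve-∀ to ℤsolve)
open import Data.List.Base using (_++_; map; length; filterᵇ; upTo; applyUpTo; cartesianProduct)
open import Data.List.Membership.Propositional using (_∈_)
open import Data.List.Membership.Propositional.Properties using (∈-map⁺; ∈-++⁺ˡ; ∈-++⁺ʳ; ∈-upTo⁺)
open import Data.List.Relation.Unary.All as All using (All; []; _∷_; all?)
open import Data.List.Relation.Unary.AllPairs using (AllPairs; []; _∷_; allPairs?)
open import Data.List.Relation.Unary.Any using (here; there)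
open import Data.Maybe.Base using (Maybe; just; nothing; maybe′; is-nothing)
open import Data.Nat
open import Data.Nat.DivMod
import Data.Nat.Divisibility as ℕD
open import Data.Nat.ListAction using (sum)
open import Data.Nat.Properties
open import Data.Nat.Tactic.RingSolver using (solve-∀)
open import Data.Product using (_,_; proj₁; proj₂)
open import Data.Product.Properties using (≡-dec)
open import Data.Rational using (mkℚ)
import Data.Rational.Properties as ℚP
open import Data.Rational.Unnormalised as ℚᵘ using (mkℚᵘ)
import Data.Rational.Unnormalised.Properties as ℚᵘP
open import Data.Sum using (_⊎_; inj₁; inj₂; [_,_]′)
open import Data.Vec.Base as Vec using (Vec; []; _∷_; here; there)
open import Function using (_∘_; case_of_)
open import Function.Bundles using (mk⇔; Equivalence)
open import Relation.Binary.Definitions using (tri<; tri≈; tri>)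
open import Relation.Binary.PropositionalEquality
open import Relation.Nullary
open import Relation.Nullary.Decidable using (from-yes)

-- Sums, filters and sublists of lists

sum-mono : ∀ {A : Set} {f g : A → ℕ} (xs : List A) → (∀ {x} → x ∈ xs → f x ≤ g x) →
  sum (map f xs) ≤ sum (map g xs)
sum-mono [] h = z≤n
sum-mono (x ∷ xs) h = +-mono-≤ (h (here refl)) (sum-mono xs (h ∘ there))

filterᵇ-cong : ∀ {A : Set} {p q : A → Bool} {xs : List A} → All (λ x → p x ≡ q x) xs →
  filterᵇ p xs ≡ filterᵇ q xs
filterᵇ-cong [] = refl
filterᵇ-cong {p = p} {q} {x ∷ xs} (e ∷ es) with p x | q x | e
... | true  | true  | refl = cong (x ∷_) (filterᵇ-cong es)
... | false | false | refl = filterᵇ-cong es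

∈-filterᵇ⁺ : ∀ {A : Set} (p : A → Bool) {x xs} → x ∈ xs → p x ≡ true → x ∈ filterᵇ p xs
∈-filterᵇ⁺ p {x} (here refl) e rewrite e = here refl
∈-filterᵇ⁺ p {xs = y ∷ _} (there h) e with p y
... | true  = there (∈-filterᵇ⁺ p h e)
... | false = ∈-filterᵇ⁺ p h e

∈-filterᵇ⁻ : ∀ {A : Set} (p : A → Bool) {x} xs → x ∈ filterᵇ p xs → p x ≡ true
∈-filterᵇ⁻ p (y ∷ ys) h with p y in e
∈-filterᵇ⁻ p (y ∷ ys) (here refl) | true = e
∈-filterᵇ⁻ p (y ∷ ys) (there h) | true = ∈-filterᵇ⁻ p ys h
... | false = ∈-filterᵇ⁻ p ys h

sublists : ∀ {A : Set} → List A → List (List A)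
sublists [] = [] ∷ []
sublists (x ∷ xs) = sublists xs ++ map (x ∷_) (sublists xs)

-- Lets a claim about every predicate on a fixed list be checked on the finite table of its
-- sublists.
filterᵇ∈sublists : ∀ {A : Set} (p : A → Bool) (xs : List A) → filterᵇ p xs ∈ sublists xs
filterᵇ∈sublists p [] = here refl
filterᵇ∈sublists p (x ∷ xs) with p x
... | true  = ∈-++⁺ʳ (sublists xs) (∈-map⁺ (x ∷_) (filterᵇ∈sublists p xs))
... | false = ∈-++⁺ˡ (filterᵇ∈sublists p xs)

-- The entries are distinct and no two of them satisfy `q`, so at most one term is nonzero.
sum-indicator≤ : ∀ {A : Set} (k : ℕ) (q : A → Bool) {xs : List A} → AllPairs _≢_ xs →
  (∀ {x y} → x ∈ xs → y ∈ xs → x ≢ y → q x ≡ true → q y ≡ true → ⊥) →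
  sum (map (λ x → if q x then k else 0) xs) ≤ k
sum-indicator≤ k q [] h = z≤n
sum-indicator≤ k q {x ∷ xs} (x≢ ∷ ap) h with q x in e
... | false = sum-indicator≤ k q ap λ i j → h (there i) (there j)
... | true = ≤-reflexive (trans (cong (λ s → k + s) (rest xs (λ i → i) x≢)) (+-identityʳ k))
  where
  rest : ∀ ys → (∀ {y} → y ∈ ys → y ∈ xs) → All (x ≢_) ys → sum (map (λ x → if q x then k else 0) ys) ≡ 0
  rest [] _ _ = refl
  rest (y ∷ ys) ⊆ (x≢y ∷ r) with q y in e′
  ... | false = rest ys (⊆ ∘ there) r
  ... | true = ⊥-elim (h (here refl) (there (⊆ (here refl))) x≢y e e′)

-- Cells, 3×3 blocks and the refund rule

Cell : Set
Cell = ℕ × ℕ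

_≡ᶜ_ : Cell → Cell → Bool
(i , j) ≡ᶜ (k , l) = (i ≡ᵇ k) ∧ (j ≡ᵇ l)

_+ᶜ_ : Cell → Cell → Cell
(i , j) +ᶜ (k , l) = i + k , j + l

-- The position of the centre (2 , 2) of a 5×5 window inside its 3×3 block with corner a.
opp : Cell → Cell
opp (i , j) = 2 ∸ i , 2 ∸ j

-- The centre comes first, so that sums over `grid3` unfold to a centre term plus a sum over `rim`.
rim grid3 : List Cell
rim = (0 , 0) ∷ (0 , 1) ∷ (0 , 2) ∷ (1 , 0) ∷ (1 , 2) ∷ (2 , 0) ∷ (2 , 1) ∷ (2 , 2) ∷ []
grid3 = (1 , 1) ∷ rim

mid : Cell → Cell
mid a = a +ᶜ (1 , 1)

inBlock : Cell → Cell → Bool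
inBlock (i , j) (k , l) = ((i ≤ᵇ k) ∧ (k ≤ᵇ 2 + i)) ∧ ((j ≤ᵇ l) ∧ (l ≤ᵇ 2 + j))

-- The identifying set of the vertex at `mid a`, in coordinates relative to the corner `a`.
pat : (Cell → Bool) → Cell → List Cell
pat p a = filterᵇ (λ c → p (a +ᶜ c)) grid3

isolated : List Cell → Cell → Bool
isolated js (i , j) = all (λ (k , l) → ((k ≡ᵇ i) ∧ (l ≡ᵇ j)) ∨ (2 ≤ᵇ ∣ i - k ∣) ∨ (2 ≤ᵇ ∣ j - l ∣)) js

-- Three pairwise non-adjacent cells of a block include exactly two extreme ones; four are all extreme.
extreme : List Cell → Cell → Bool
extreme js (i , j) = not (i ≡ᵇ 1) ∧ not (j ≡ᵇ 1) ∧ any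
  (λ (k , l) → 5 ≤ᵇ ∣ i - k ∣ * ∣ i - k ∣ + ∣ j - l ∣ * ∣ j - l ∣) js

-- In units of 1/2: σ js c is the refund that a vertex whose block has the codewords js pays to the codeword c,
-- and α js c is what c contributes to |I(u)| + [ |I(u)| = 1 ].  Distributing (|I(u)| − 2)⁺ equally over the
-- isolated codewords would leave some windows short; paying only the extreme ones is enough.
σ : List Cell → Cell → ℕ
σ js c = if any (c ≡ᶜ_) js ∧ (3 ≤ᵇ length js) ∧ isolated js c
  then (if all (isolated js) js then (if extreme js c then 1 else 0) else 2) else 0

α : List Cell → Cell → ℕ
α js c = if any (c ≡ᶜ_) js then 2 + (if length js ≡ᵇ 1 then 2 else 0) else 0

-- Searching all 5×5 windows

Partial : Set
Partial = List (List (Maybe Bool))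

nth : ∀ {A : Set} → A → List A → ℕ → A
nth d []       _       = d
nth d (x ∷ _)  zero    = x
nth d (_ ∷ xs) (suc n) = nth d xs n

update : ∀ {A : Set} → (A → A) → List A → ℕ → List A
update f []       _       = []
update f (x ∷ xs) zero    = f x ∷ xs
update f (x ∷ xs) (suc n) = x ∷ update f xs n

get : Partial → Cell → Maybe Bool
get w (i , j) = nth nothing (nth [] w i) j

_[_≔_] : Partial → Cell → Bool → Partial
w [ (i , j) ≔ b ] = update (λ row → update (λ _ → just b) row j) w i

known : Partial → Cell → List Cell → Maybe (List Cell)
known w a [] = just []
known w a (c ∷ cs) with get w (a +ᶜ c)
... | nothing = nothing
... | just b with known w a cs
...   | nothing = nothing
...   | just js = just (if b then c ∷ js else js)

-- `σ` is not monotone in the codewords of a block: a further one may destroy isolation. Hence a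
-- block with an undecided cell guarantees only 0.
received : Partial → Cell → ℕ
received w a = maybe′ (λ js → σ js (opp a)) 0 (known w a grid3)

-- An undecided cell may still be a codeword, so the default `false` is the safe one.
absent : Partial → Cell → Bool
absent w c = maybe′ not false (get w c)

_⟪_⊆_⟫ : Partial → Cell → Cell → Bool
w ⟪ a ⊆ b ⟫ = all (λ c → absent w (a +ᶜ c) ∨ inBlock b (a +ᶜ c)) grid3

clashing : Partial → Cell → Cell → Bool
clashing w a b = not (a ≡ᶜ b) ∧ w ⟪ a ⊆ b ⟫ ∧ w ⟪ b ⊆ a ⟫

clash : Partial → Bool
clash w = any (λ a → any (clashing w a) rim) rim

-- Already decided cells either contradict separation or guarantee a refund of 1.
stop : Partial → Bool
stop w = clash w ∨ (2 ≤ᵇ sum (map (received w) rim))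

search : List Cell → Partial → Bool
search []       w = stop w
search (c ∷ cs) w = stop w ∨ (search cs (w [ c ≔ false ]) ∧ search cs (w [ c ≔ true ]))

-- The central codeword is isolated, and is the only codeword in the block with corner a.
initial : Cell → Cell → Maybe Bool
initial a c = if c ≡ᶜ (2 , 2) then just true else
  (if inBlock (1 , 1) c ∨ inBlock a c then just false else nothing)

start : Cell → Partial
start a = applyUpTo (λ i → applyUpTo (λ j → initial a (i , j)) 5) 5

unknown : Partial → List Cell
unknown w = filterᵇ (λ c → is-nothing (get w c)) (cartesianProduct (upTo 5) (upTo 5))

-- Reflection of the Boolean tests

∧-true : ∀ {x y} → x ∧ y ≡ true → x ≡ true × y ≡ true
∧-true {true} e = refl , e

∨-true : ∀ {x y} → x ∨ y ≡ true → x ≡ true ⊎ y ≡ true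
∨-true {true}  e = inj₁ e
∨-true {false} e = inj₂ e

≡true : ∀ {x} → T x → x ≡ true
≡true = Equivalence.to T-≡

isT : ∀ {x} → x ≡ true → T x
isT = Equivalence.from T-≡

all-true : ∀ {A : Set} (p : A → Bool) {xs x} → all p xs ≡ true → x ∈ xs → p x ≡ true
all-true p h (here refl) = proj₁ (∧-true h)
all-true p h (there x∈) = all-true p (proj₂ (∧-true h)) x∈

any-true⁻ : ∀ {A : Set} (p : A → Bool) xs → any p xs ≡ true → ∃[ x ] x ∈ xs × p x ≡ true
any-true⁻ p (x ∷ xs) h with ∨-true h
... | inj₁ px = x , here refl , px
... | inj₂ h′ = let y , y∈ , py = any-true⁻ p xs h′ in y , there y∈ , py

≡ᶜ⇒≡ : ∀ c e → (c ≡ᶜ e) ≡ true → c ≡ e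
≡ᶜ⇒≡ (i , j) (k , l) h = let h₁ , h₂ = ∧-true h in cong₂ _,_ (≡ᵇ⇒≡ i k (isT h₁)) (≡ᵇ⇒≡ j l (isT h₂))

≡ᶜ-refl : ∀ c → (c ≡ᶜ c) ≡ true
≡ᶜ-refl (i , j) = cong₂ _∧_ (≡true (≡⇒≡ᵇ i i refl)) (≡true (≡⇒≡ᵇ j j refl))

∈grid3 : ∀ {m n} → m ≤ 2 → n ≤ 2 → (m , n) ∈ grid3
∈grid3 {0} {0} _ _ = there (here refl)
∈grid3 {0} {1} _ _ = there (there (here refl))
∈grid3 {0} {2} _ _ = there (there (there (here refl)))
∈grid3 {1} {0} _ _ = there (there (there (there (here refl))))
∈grid3 {1} {1} _ _ = here refl
∈grid3 {1} {2} _ _ = there (there (there (there (there (here refl)))))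
∈grid3 {2} {0} _ _ = there (there (there (there (there (there (here refl))))))
∈grid3 {2} {1} _ _ = there (there (there (there (there (there (there (here refl)))))))
∈grid3 {2} {2} _ _ = there (there (there (there (there (there (there (there (here refl))))))))
∈grid3 {suc (suc (suc _))} (s≤s (s≤s ())) _
∈grid3 {0} {suc (suc (suc _))} _ (s≤s (s≤s ()))
∈grid3 {1} {suc (suc (suc _))} _ (s≤s (s≤s ()))
∈grid3 {2} {suc (suc (suc _))} _ (s≤s (s≤s ()))

inBlock⁻ : ∀ a c → inBlock a c ≡ true → ∃[ k ] k ∈ grid3 × c ≡ a +ᶜ k
inBlock⁻ (i , j) (k , l) h with ∧-true h
... | hi , hj with offset i k hi | offset j l hj
  where
  offset : ∀ i k → (i ≤ᵇ k) ∧ (k ≤ᵇ 2 + i) ≡ true → ∃[ m ] m ≤ 2 × k ≡ i + m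
  offset i k h with ∧-true h
  ... | h₁ , h₂ = k ∸ i , subst (k ∸ i ≤_) (m+n∸n≡m 2 i) (∸-monoˡ-≤ i (≤ᵇ⇒≤ k (2 + i) (isT h₂))) ,
    sym (m+[n∸m]≡n (≤ᵇ⇒≤ i k (isT h₁)))
... | m , m≤2 , refl | n , n≤2 , refl = (m , n) , ∈grid3 m≤2 n≤2 , refl

grid3-≤ : ∀ {k} → k ∈ grid3 → proj₁ k ≤ 2 × proj₂ k ≤ 2
grid3-≤ = All.lookup (from-yes (all? (λ k → (proj₁ k ≤? 2) ×-dec (proj₂ k ≤? 2)) grid3))

inBlock-+ : ∀ a {k} → k ∈ grid3 → inBlock a (a +ᶜ k) ≡ true
inBlock-+ (i , j) {k , l} k∈ = cong₂ _∧_ (side i (proj₁ (grid3-≤ k∈))) (side j (proj₂ (grid3-≤ k∈)))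
  where
  side : ∀ i {k} → k ≤ 2 → (i ≤ᵇ i + k) ∧ (i + k ≤ᵇ 2 + i) ≡ true
  side i {k} k≤2 = cong₂ _∧_ (≡true (≤⇒≤ᵇ (m≤m+n i k)))
    (≡true (≤⇒≤ᵇ (≤-trans (+-monoʳ-≤ i k≤2) (≤-reflexive (+-comm i 2)))))

-- `opp` permutes `grid3`, so both sums run over all positions of the block. One codeword gives 4 on
-- the right and no refund; for m ≥ 2 codewords the claim is that refunds total at most 2(m - 2).
-- The table covers all 512 patterns, and the hypotheses exclude the empty one.
block-inequality : ∀ (p : Cell → Bool) a {c} → c ∈ grid3 → p (a +ᶜ c) ≡ true →
  4 + sum (map (σ (pat p a) ∘ opp) grid3) ≤ sum (map (α (pat p a) ∘ opp) grid3)
block-inequality p a c∈ pc =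
  [ (λ e → ⊥-elim (nonempty (∈-filterᵇ⁺ (λ c → p (a +ᶜ c)) c∈ pc) e)) , (λ e → ≤ᵇ⇒≤ _ _ (isT e)) ]′
  (∨-true (all-true (λ js → (length js ≡ᵇ 0) ∨ bound js) table (filterᵇ∈sublists (λ c → p (a +ᶜ c)) grid3)))
  where
  bound : List Cell → Bool
  bound js = 4 + sum (map (σ js ∘ opp) grid3) ≤ᵇ sum (map (α js ∘ opp) grid3)
  table : all (λ js → (length js ≡ᵇ 0) ∨ bound js) (sublists grid3) ≡ true
  table = refl
  nonempty : ∀ {A : Set} {x : A} {xs} → x ∈ xs → (length xs ≡ᵇ 0) ≡ true → ⊥
  nonempty (here _) ()
  nonempty (there _) ()

-- Soundness of the window search

_⟨_⊆_⟩ : (Cell → Bool) → Cell → Cell → Set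
p ⟨ a ⊆ b ⟩ = ∀ {c} → c ∈ grid3 → p (a +ᶜ c) ≡ true → inBlock b (a +ᶜ c) ≡ true

-- The locating property for the eight neighbours of the centre (2 , 2): mutual inclusion means that
-- two non-codewords have equal identifying sets.
Separated : (Cell → Bool) → Set
Separated p = ∀ {a b} → a ∈ rim → b ∈ rim → a ≢ b → p (mid a) ≡ false → p (mid b) ≡ false →
  p ⟨ a ⊆ b ⟩ → p ⟨ b ⊆ a ⟩ → ⊥

Private : (Cell → Bool) → Cell → Set
Private p a = ∀ {c} → inBlock a c ≡ true → p c ≡ true → c ≡ (2 , 2)

private-empty : ∀ {p b c} → Private p b → inBlock b c ≡ true → c ≢ (2 , 2) → p c ≡ false
private-empty {p} {c = c} pr h c≢ with p c in pc
... | false = refl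
... | true  = ⊥-elim (c≢ (pr h pc))

record _⊑_ (w : Partial) (p : Cell → Bool) : Set where
  constructor extends
  field agrees : ∀ c {b} → get w c ≡ just b → p c ≡ b

open _⊑_

nth-update : ∀ {A : Set} (d : A) f xs m n → nth d (update f xs m) n ≡ nth d xs n ⊎
  (m ≡ n × nth d (update f xs m) n ≡ f (nth d xs n))
nth-update d f []       m       n       = inj₁ refl
nth-update d f (x ∷ xs) zero    zero    = inj₂ (refl , refl)
nth-update d f (x ∷ xs) zero    (suc n) = inj₁ refl
nth-update d f (x ∷ xs) (suc m) zero    = inj₁ refl
nth-update d f (x ∷ xs) (suc m) (suc n) with nth-update d f xs m n
... | inj₁ e = inj₁ e
... | inj₂ (refl , e) = inj₂ (refl , e)

update-⊑ : ∀ {w p} c {b} → w ⊑ p → p c ≡ b → (w [ c ≔ b ]) ⊑ p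
update-⊑ {w} {p} (i , j) {b} w⊑p pc = extends λ { (k , l) → agree k l }
  where
  agree : ∀ k l {x} → get (w [ (i , j) ≔ b ]) (k , l) ≡ just x → p (k , l) ≡ x
  agree k l e with nth-update [] (λ row → update (λ _ → just b) row j) w i k
  ... | inj₁ e₁ = agrees w⊑p (k , l) (trans (sym (cong (λ row → nth nothing row l) e₁)) e)
  ... | inj₂ (refl , e₁) with nth-update nothing (λ _ → just b) (nth [] w i) j l
  ...   | inj₁ e₂ = agrees w⊑p (k , l) (trans (sym e₂) (trans (sym (cong (λ row → nth nothing row l) e₁)) e))
  ...   | inj₂ (refl , e₂) with trans (sym e) (trans (cong (λ row → nth nothing row l) e₁) e₂)
  ...     | refl = pc

known-⊑ : ∀ {w p} a cs {js} → w ⊑ p → known w a cs ≡ just js → filterᵇ (λ c → p (a +ᶜ c)) cs ≡ js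
known-⊑ a [] w⊑p refl = refl
known-⊑ {w} {p} a (c ∷ cs) w⊑p e with get w (a +ᶜ c) in e₁
... | just b with known w a cs in e₂
...   | just js rewrite agrees w⊑p (a +ᶜ c) e₁ with b | e
...     | true  | refl = cong (c ∷_) (known-⊑ a cs w⊑p e₂)
...     | false | refl = known-⊑ a cs w⊑p e₂

received-⊑ : ∀ {w p} a → w ⊑ p → received w a ≤ σ (pat p a) (opp a)
received-⊑ {w} a w⊑p with known w a grid3 in e
... | nothing = z≤n
... | just js rewrite known-⊑ a grid3 w⊑p e = ≤-refl

absent-⊑ : ∀ {w p} c → w ⊑ p → absent w c ≡ true → p c ≡ false
absent-⊑ {w} c w⊑p h with get w c in e
... | just false = agrees w⊑p c e

covered-⊑ : ∀ {w p} a b → w ⊑ p → w ⟪ a ⊆ b ⟫ ≡ true → p ⟨ a ⊆ b ⟩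
covered-⊑ {w} a b w⊑p h {c} c∈ pc
  with ∨-true {absent w (a +ᶜ c)} (all-true (λ c → absent w (a +ᶜ c) ∨ inBlock b (a +ᶜ c)) h c∈)
... | inj₁ e = case trans (sym pc) (absent-⊑ (a +ᶜ c) w⊑p e) of λ ()
... | inj₂ e = e

rim-received : (Cell → Bool) → ℕ
rim-received p = sum (map (λ a → σ (pat p a) (opp a)) rim)

module _ {p : Cell → Bool} (sep : Separated p) (lonely : ∀ {a} → a ∈ rim → p (mid a) ≡ false) where

  -- A clash is certified by decided cells alone, so it persists in `p`; by `lonely` it concerns two
  -- non-codewords and contradicts `sep`. Otherwise `received` underestimates the true refunds.
  stop-⊑ : ∀ {w} → w ⊑ p → stop w ≡ true → 2 ≤ rim-received p
  stop-⊑ {w} w⊑p h = [ (λ e → ⊥-elim (no-clash e)) , enough ]′ (∨-true {clash w} h)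
    where
    enough : (2 ≤ᵇ sum (map (received w) rim)) ≡ true → 2 ≤ rim-received p
    enough e = ≤-trans (≤ᵇ⇒≤ 2 _ (isT e)) (sum-mono {f = received w} rim λ {a} _ → received-⊑ a w⊑p)
    no-clash : clash w ≡ true → ⊥
    no-clash e =
      let a , a∈ , e₁ = any-true⁻ (λ a → any (clashing w a) rim) rim e
          b , b∈ , e₂ = any-true⁻ (clashing w a) rim e₁
          a≢b , e₃ = ∧-true {not (a ≡ᶜ b)} e₂
          ab , ba = ∧-true {w ⟪ a ⊆ b ⟫} e₃
      in sep a∈ b∈ (λ a≡b → case trans (sym a≢b) (cong not (trans (cong (_≡ᶜ b) a≡b) (≡ᶜ-refl b))) of λ ())
           (lonely a∈) (lonely b∈) (covered-⊑ a b w⊑p ab) (covered-⊑ b a w⊑p ba)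

  -- Descending into the branch that holds the actual value of `p` at each cell keeps the partial
  -- window in agreement with `p`.
  search-⊑ : ∀ cs {w} → w ⊑ p → search cs w ≡ true → 2 ≤ rim-received p
  search-⊑ [] w⊑p h = stop-⊑ w⊑p h
  search-⊑ (c ∷ cs) {w} w⊑p h with ∨-true {stop w} h
  ... | inj₁ e = stop-⊑ w⊑p e
  ... | inj₂ e with ∧-true {search cs (w [ c ≔ false ])} e | p c in pc
  ...   | h₀ , h₁ | false = search-⊑ cs (update-⊑ c w⊑p pc) h₀
  ...   | h₀ , h₁ | true  = search-⊑ cs (update-⊑ c w⊑p pc) h₁

nth-applyUpTo : ∀ {A : Set} (d : A) f n i → nth d (applyUpTo f n) i ≡ d ⊎ nth d (applyUpTo f n) i ≡ f i
nth-applyUpTo d f zero    i       = inj₁ refl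
nth-applyUpTo d f (suc n) zero    = inj₂ refl
nth-applyUpTo d f (suc n) (suc i) = nth-applyUpTo d (f ∘ suc) n i

start-⊑ : ∀ {p a} → p (2 , 2) ≡ true → Private p (1 , 1) → Private p a → start a ⊑ p
start-⊑ {p} {a} p₂₂ pr₁ pr₂ = extends agree
  where
  ≢centre : ∀ c → (c ≡ᶜ (2 , 2)) ≡ false → c ≢ (2 , 2)
  ≢centre c e refl = case e of λ ()
  initial-⊑ : ∀ {b} c → initial a c ≡ just b → p c ≡ b
  initial-⊑ c e with c ≡ᶜ (2 , 2) in e₀
  initial-⊑ c refl | true = trans (cong p (≡ᶜ⇒≡ c (2 , 2) e₀)) p₂₂
  initial-⊑ c e | false with inBlock (1 , 1) c ∨ inBlock a c in e₁
  initial-⊑ c refl | false | true with ∨-true {inBlock (1 , 1) c} e₁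
  ... | inj₁ h = private-empty {b = 1 , 1} pr₁ h (≢centre c e₀)
  ... | inj₂ h = private-empty {b = a} pr₂ h (≢centre c e₀)
  agree : ∀ c {b} → get (start a) c ≡ just b → p c ≡ b
  agree (i , j) e with nth-applyUpTo [] (λ i → applyUpTo (λ j → initial a (i , j)) 5) 5 i
  ... | inj₁ e₁ = case trans (sym (cong (λ row → nth nothing row j) e₁)) e of λ ()
  ... | inj₂ e₁ with nth-applyUpTo nothing (λ j → initial a (i , j)) 5 j
  ...   | inj₁ e₂ = case trans (sym (trans (cong (λ row → nth nothing row j) e₁) e₂)) e of λ ()
  ...   | inj₂ e₂ = initial-⊑ (i , j) (trans (sym (trans (cong (λ row → nth nothing row j) e₁) e₂)) e)

-- One evaluation of the search for each of the eight positions of a private neighbour.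
search-succeeds : All (λ a → search (unknown (start a)) (start a) ≡ true) rim
search-succeeds = refl ∷ refl ∷ refl ∷ refl ∷ refl ∷ refl ∷ refl ∷ refl ∷ []

-- The share of a single codeword

Σσ Σα : (Cell → Bool) → ℕ
Σσ p = sum (map (λ a → σ (pat p a) (opp a)) grid3)
Σα p = sum (map (λ a → α (pat p a) (opp a)) grid3)

single : (Cell → Bool) → Cell → Bool
single p a = length (pat p a) ≡ᵇ 1

+opp : All (λ a → a +ᶜ opp a ≡ (2 , 2)) grid3
+opp = refl ∷ refl ∷ refl ∷ refl ∷ refl ∷ refl ∷ refl ∷ refl ∷ refl ∷ []

opp∈grid3 : All (λ a → opp a ∈ grid3) grid3
opp∈grid3 = All.tabulate λ {a} a∈ → ∈grid3 (m∸n≤m 2 (proj₁ a)) (m∸n≤m 2 (proj₂ a))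

-- The centre is a codeword of block `a`, at position `opp a`, so it is the only one there.
single⇒private : ∀ {p a} → a ∈ grid3 → p (2 , 2) ≡ true → single p a ≡ true → Private p a
single⇒private {p} {a} a∈ p₂₂ h {c} c∈ pc with inBlock⁻ a c c∈
... | k , k∈ , refl = trans (cong (a +ᶜ_) (unique (pat p a) h (∈-filterᵇ⁺ (λ c → p (a +ᶜ c)) k∈ pc)
    (∈-filterᵇ⁺ (λ c → p (a +ᶜ c)) (All.lookup opp∈grid3 a∈) (trans (cong p (All.lookup +opp a∈)) p₂₂))))
  (All.lookup +opp a∈)
  where
  unique : ∀ {A : Set} {x y : A} xs → (length xs ≡ᵇ 1) ≡ true → x ∈ xs → y ∈ xs → x ≡ y
  unique (_ ∷ []) _ (here refl) (here refl) = refl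

α≡0 : ∀ {p a} → a ∈ grid3 → p (2 , 2) ≡ false → α (pat p a) (opp a) ≡ 0
α≡0 {p} {a} a∈ p₂₂ with any (opp a ≡ᶜ_) (pat p a) in e
... | false = refl
... | true with any-true⁻ _ (pat p a) e
...   | x , x∈ , h with ≡ᶜ⇒≡ (opp a) x h
...     | refl = case trans (sym (∈-filterᵇ⁻ (λ c → p (a +ᶜ c)) grid3 x∈))
  (trans (cong p (All.lookup +opp a∈)) p₂₂) of λ ()

sum-map-+ : ∀ {A : Set} (f g : A → ℕ) xs → sum (map (λ x → f x + g x) xs) ≡ sum (map f xs) + sum (map g xs)
sum-map-+ f g [] = refl
sum-map-+ f g (x ∷ xs) rewrite sum-map-+ f g xs = +-exchange (f x) (g x) _ _
  where
  +-exchange : ∀ a b c d → a + b + (c + d) ≡ a + c + (b + d)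
  +-exchange = solve-∀

sum-singles : (p : Cell → Bool) → sum (map (λ a → 2 + (if single p a then 2 else 0)) grid3) ≡
  18 + ((if single p (1 , 1) then 2 else 0) + sum (map (λ a → if single p a then 2 else 0) rim))
sum-singles p = sum-map-+ (λ _ → 2) (λ a → if single p a then 2 else 0) grid3

α≤ : ∀ p a → α (pat p a) (opp a) ≤ 2 + (if single p a then 2 else 0)
α≤ p a with any (opp a ≡ᶜ_) (pat p a)
... | true  = ≤-refl
... | false = z≤n

rim-distinct : AllPairs _≢_ rim
rim-distinct = from-yes (allPairs? (λ c e → ¬? (≡-dec _≟_ _≟_ c e)) rim)

rim-off-centre : All (λ a → mid a ≢ (2 , 2)) rim
rim-off-centre = (λ ()) ∷ (λ ()) ∷ (λ ()) ∷ (λ ()) ∷ (λ ()) ∷ (λ ()) ∷ (λ ()) ∷ (λ ()) ∷ []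

rim-inner : All (λ a → inBlock (1 , 1) (mid a) ≡ true × inBlock a (mid a) ≡ true × inBlock a (2 , 2) ≡ true)
  rim
rim-inner = yes³ ∷ yes³ ∷ yes³ ∷ yes³ ∷ yes³ ∷ yes³ ∷ yes³ ∷ yes³ ∷ []
  where
  yes³ : true ≡ true × true ≡ true × true ≡ true
  yes³ = refl , refl , refl

private-⊆ : ∀ {p a b} → b ∈ rim → Private p a → p ⟨ a ⊆ b ⟩
private-⊆ {a = a} {b} b∈ pr c∈ pc =
  trans (cong (inBlock b) (pr (inBlock-+ a c∈) pc)) (proj₂ (proj₂ (All.lookup rim-inner b∈)))

-- Each of the nine blocks counts 2, and 2 more if the centre is its only codeword. This extra
-- occurs for at most one rim block, so 20 is exceeded only if the centre's own block and a rim
-- block are both single; then the search supplies the missing 2 from refunds.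
codeword-share : ∀ {p} → p (2 , 2) ≡ true → Separated p → Σα p ≤ 20 + Σσ p
codeword-share {p} p₂₂ sep = ≤-trans (sum-mono {f = λ a → α (pat p a) (opp a)} grid3 (λ {a} _ → α≤ p a))
  (≤-trans (≤-reflexive (sum-singles p)) (+-monoʳ-≤ 18 bound))
  where
  privately : ∀ {a} → a ∈ grid3 → single p a ≡ true → Private p a
  privately a∈ = single⇒private a∈ p₂₂
  -- Two such neighbours would be non-codewords that both see exactly the centre.
  at-most-one : sum (map (λ a → if single p a then 2 else 0) rim) ≤ 2
  at-most-one = sum-indicator≤ 2 (single p) rim-distinct λ {a} {b} a∈ b∈ a≢b sa sb →
    let pa = privately (there a∈) sa ; pb = privately (there b∈) sb in
    sep a∈ b∈ a≢b
      (private-empty {b = a} pa (proj₁ (proj₂ (All.lookup rim-inner a∈))) (All.lookup rim-off-centre a∈))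
      (private-empty {b = b} pb (proj₁ (proj₂ (All.lookup rim-inner b∈))) (All.lookup rim-off-centre b∈))
      (private-⊆ b∈ pa) (private-⊆ a∈ pb)
  none : any (single p) rim ≡ false → sum (map (λ a → if single p a then 2 else 0) rim) ≡ 0
  none = go rim
    where
    go : ∀ xs → any (single p) xs ≡ false → sum (map (λ a → if single p a then 2 else 0) xs) ≡ 0
    go [] _ = refl
    go (x ∷ xs) h with single p x
    ... | false = go xs h
  bound : (if single p (1 , 1) then 2 else 0) + sum (map (λ a → if single p a then 2 else 0) rim) ≤ 2 + Σσ p
  bound with single p (1 , 1) in e₁ | any (single p) rim in e₂
  ... | false | _     = ≤-trans at-most-one (m≤m+n 2 _)
  ... | true  | false rewrite none e₂ = s≤s (s≤s z≤n)
  ... | true  | true with any-true⁻ (single p) rim e₂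
  ...   | a , a∈ , sa = +-monoʳ-≤ 2 (≤-trans at-most-one
      (≤-trans rim-gives (m≤n+m _ (σ (pat p (1 , 1)) (1 , 1)))))
    where
    c₁ : Private p (1 , 1)
    c₁ = privately (here refl) e₁
    rim-gives : 2 ≤ rim-received p
    rim-gives = search-⊑ sep
      (λ {b} b∈ → private-empty {b = 1 , 1} c₁ (proj₁ (All.lookup rim-inner b∈))
          (All.lookup rim-off-centre b∈))
      (unknown (start a)) (start-⊑ {a = a} p₂₂ c₁ (privately (there a∈) sa)) (All.lookup search-succeeds a∈)

-- Codes in ℤ_n as periodic functions on ℕ

look : ∀ {n} → Vec Bool n → ℕ → Bool
look []       _       = false
look (b ∷ _)  zero    = b
look (_ ∷ bs) (suc x) = look bs x

look⁺ : ∀ {n} {C : Subset n} {c} → c ∈ₛ C → look C (toℕ c) ≡ true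
look⁺ here = refl
look⁺ (there h) = look⁺ h

look⁻ : ∀ {n} (C : Subset n) c → look C (toℕ c) ≡ true → c ∈ₛ C
look⁻ (true ∷ _) Fin.zero refl = here
look⁻ (_ ∷ C) (Fin.suc c) h = there (look⁻ C c h)

pos : ℕ → Cell → ℕ
pos d (i , j) = i + j * d

pos-+ : ∀ d a c → pos d (a +ᶜ c) ≡ pos d a + pos d c
pos-+ d (i , j) (k , l) = eq i j k l d
  where
  eq : ∀ i j k l d → i + k + (j + l) * d ≡ i + j * d + (k + l * d)
  eq = solve-∀

circ : ℕ → List ℕ
circ d = 1 ∷ (d ∸ 1) ∷ d ∷ (d + 1) ∷ []

-- Congruence modulo n and its vertices

infix 4 _≋_[mod_]

-- The quotient is an explicit integer, so either side may be the larger one and the laws become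
-- ring identities.
record _≋_[mod_] (x y n : ℕ) : Set where
  constructor cong-mod
  field
    quot : ℤ
    eqn : + x ≡ + y ℤ.+ quot ℤ.* + n

open _≋_[mod_]

module _ {n : ℕ} where

  ≋-refl : ∀ {x} → x ≋ x [mod n ]
  ≋-refl {x} = cong-mod (+ 0) (sym (ℤP.+-identityʳ (+ x)))

  ≡⇒≋ : ∀ {x y} → x ≡ y → x ≋ y [mod n ]
  ≡⇒≋ refl = ≋-refl

  ≋-sym : ∀ {x y} → x ≋ y [mod n ] → y ≋ x [mod n ]
  ≋-sym {x} {y} (cong-mod q e) = cong-mod (ℤ.- q)
    (trans (eq (+ y) q (+ n)) (cong (ℤ._+ (ℤ.- q) ℤ.* + n) (sym e)))
    where
    eq : ∀ y q n → y ≡ y ℤ.+ q ℤ.* n ℤ.+ (ℤ.- q) ℤ.* n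
    eq = ℤsolve

  ≋-trans : ∀ {x y z} → x ≋ y [mod n ] → y ≋ z [mod n ] → x ≋ z [mod n ]
  ≋-trans {x} {y} {z} (cong-mod q e) (cong-mod r f) = cong-mod (r ℤ.+ q)
    (trans e (trans (cong (ℤ._+ q ℤ.* + n) f) (eq (+ z) q r (+ n))))
    where
    eq : ∀ z q r n → z ℤ.+ r ℤ.* n ℤ.+ q ℤ.* n ≡ z ℤ.+ (r ℤ.+ q) ℤ.* n
    eq = ℤsolve

  ≋-+ʳ : ∀ {x y} k → x ≋ y [mod n ] → x + k ≋ y + k [mod n ]
  ≋-+ʳ {x} {y} k (cong-mod q e) = cong-mod q
    (trans (ℤP.pos-+ x k) (trans (cong (ℤ._+ + k) e)
        (trans (eq (+ y) q (+ n) (+ k)) (cong (ℤ._+ q ℤ.* + n) (sym (ℤP.pos-+ y k))))))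
    where
    eq : ∀ y q n k → y ℤ.+ q ℤ.* n ℤ.+ k ≡ y ℤ.+ k ℤ.+ q ℤ.* n
    eq = ℤsolve

  +-cancelʳ-≋ : ∀ {x y} k → x + k ≋ y + k [mod n ] → x ≋ y [mod n ]
  +-cancelʳ-≋ {x} {y} k (cong-mod q e) = cong-mod q
    (trans (eq₁ (+ x) (+ k)) (trans (cong (ℤ._- + k)
        (trans (sym (ℤP.pos-+ x k)) (trans e (cong (ℤ._+ q ℤ.* + n) (ℤP.pos-+ y k)))))
      (eq₂ (+ y) q (+ n) (+ k))))
    where
    eq₁ : ∀ x k → x ≡ x ℤ.+ k ℤ.- k
    eq₁ = ℤsolve
    eq₂ : ∀ y q n k → y ℤ.+ k ℤ.+ q ℤ.* n ℤ.- k ≡ y ℤ.+ q ℤ.* n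
    eq₂ = ℤsolve

  ≋-nonneg : ∀ {x y} q → + x ≡ + y ℤ.+ + q ℤ.* + n → x ≡ y + q * n
  ≋-nonneg {x} {y} q e = ℤP.+-injective
    (trans e (trans (cong (λ s → + y ℤ.+ s) (sym (ℤP.pos-* q n))) (sym (ℤP.pos-+ y (q * n)))))

module _ {n : ℕ} .{{_ : NonZero n}} where

  ≋⇒%≡ : ∀ {x y} → x ≋ y [mod n ] → x % n ≡ y % n
  ≋⇒%≡ {x} {y} (cong-mod (+ q) e) = trans (cong (_% n) (≋-nonneg {n} {x} {y} q e)) ([m+kn]%n≡m%n y q n)
  ≋⇒%≡ {x} {y} h@(cong-mod -[1+ q ] _) =
    sym (trans (cong (_% n) (≋-nonneg {n} {y} {x} (suc q) (eqn (≋-sym {n} {x} {y} h))))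
        ([m+kn]%n≡m%n x (suc q) n))

  %-≋ : ∀ x → x % n ≋ x [mod n ]
  %-≋ x = ≋-sym (cong-mod (+ (x / n)) (trans (cong +_ (m≡m%n+[m/n]*n x n))
    (trans (ℤP.pos-+ (x % n) (x / n * n)) (cong (λ s → + (x % n) ℤ.+ s) (ℤP.pos-* (x / n) n)))))

  -- All reasoning about `vertex` goes through `vertex-≋`, so its remainder never has to unfold.
  abstract
    vertex : ℕ → Fin n
    vertex x = fromℕ< (m%n<n x n)

    vertex-≋ : ∀ x → toℕ (vertex x) ≋ x [mod n ]
    vertex-≋ x = ≋-trans (≡⇒≋ (toℕ-fromℕ< (m%n<n x n))) (%-≋ x)

  ≋⇒≡ : {u v : Fin n} → toℕ u ≋ toℕ v [mod n ] → u ≡ v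
  ≋⇒≡ {u} {v} h = toℕ-injective (trans (sym (m<n⇒m%n≡m (toℕ<n u))) (trans (≋⇒%≡ h) (m<n⇒m%n≡m (toℕ<n v))))

  code : Subset n → ℕ → Bool
  code C x = look C (x % n)

  code-≋ : ∀ C {x y} → x ≋ y [mod n ] → code C x ≡ code C y
  code-≋ C h = cong (look C) (≋⇒%≡ h)

  code⁺ : ∀ {C c x} → toℕ c ≋ x [mod n ] → c ∈ₛ C → code C x ≡ true
  code⁺ {C} {c} h c∈ = trans (sym (code-≋ C h)) (trans (cong (look C) (m<n⇒m%n≡m (toℕ<n c))) (look⁺ c∈))

  code⁻ : ∀ {C c x} → toℕ c ≋ x [mod n ] → code C x ≡ true → c ∈ₛ C
  code⁻ {C} {c} h e = look⁻ C c (trans (sym (trans (sym (code-≋ C h)) (cong (look C) (m<n⇒m%n≡m (toℕ<n c)))))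
      e)

-- Here `x` is the corner of the block around `u`. With `u` at (1 , 1), negative displacements also
-- lead to cells with natural coordinates.
module Neighbourhood {n d : ℕ} .{{_ : NonZero n}} (d≥1 : 1 ≤ d) {u : Fin n} {x : ℕ}
  (u≋ : toℕ u ≋ x + pos d (1 , 1) [mod n ]) where

  +pos : ∀ i j → + pos d (i , j) ≡ + i ℤ.+ + j ℤ.* + d
  +pos i j = trans (ℤP.pos-+ i (j * d)) (cong (λ s → + i ℤ.+ s) (ℤP.pos-* j d))

  -- Treats all eight displacements alike: `δ` is a signed integer, and `e⁺`, `e⁻` below bring the
  -- summand `+ d` of `Adj` to the form `- δ`.
  module _ {v : Fin n} (i j : ℕ) (δ : ℤ) (δ≡ : + i ℤ.+ + j ℤ.* + d ≡ + 1 ℤ.+ + 1 ℤ.* + d ℤ.+ δ) where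

    to : (+ n) ℤD.∣ (toℤ v ℤ.- toℤ u ℤ.- δ) → toℕ v ≋ x + pos d (i , j) [mod n ]
    to h with ℤS.∣ᵤ⇒∣ {+ n} {toℤ v ℤ.- toℤ u ℤ.- δ} h
    ... | ℤS.divides q e = cong-mod (quot u≋ ℤ.+ q) (begin
      toℤ v ≡⟨ eq₁ (toℤ v) (toℤ u) δ ⟩
      (toℤ v ℤ.- toℤ u ℤ.- δ) ℤ.+ toℤ u ℤ.+ δ ≡⟨ cong₂ (λ s t → s ℤ.+ t ℤ.+ δ) e (eqn u≋) ⟩
      q ℤ.* + n ℤ.+ (+ (x + pos d (1 , 1)) ℤ.+ quot u≋ ℤ.* + n) ℤ.+ δ
        ≡⟨ cong (λ s → q ℤ.* + n ℤ.+ (s ℤ.+ quot u≋ ℤ.* + n) ℤ.+ δ)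
            (trans (ℤP.pos-+ x _) (cong (λ s → + x ℤ.+ s) (+pos 1 1))) ⟩
      q ℤ.* + n ℤ.+ (+ x ℤ.+ (+ 1 ℤ.+ + 1 ℤ.* + d) ℤ.+ quot u≋ ℤ.* + n) ℤ.+ δ
        ≡⟨ eq₂ (+ x) (+ 1 ℤ.+ + 1 ℤ.* + d) q (quot u≋) (+ n) δ ⟩
      + x ℤ.+ (+ 1 ℤ.+ + 1 ℤ.* + d ℤ.+ δ) ℤ.+ (quot u≋ ℤ.+ q) ℤ.* + n
        ≡⟨ cong (λ s → + x ℤ.+ s ℤ.+ (quot u≋ ℤ.+ q) ℤ.* + n) (trans (sym δ≡) (sym (+pos i j))) ⟩
      + x ℤ.+ + pos d (i , j) ℤ.+ (quot u≋ ℤ.+ q) ℤ.* + n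
        ≡⟨ cong (ℤ._+ (quot u≋ ℤ.+ q) ℤ.* + n) (sym (ℤP.pos-+ x _)) ⟩
      + (x + pos d (i , j)) ℤ.+ (quot u≋ ℤ.+ q) ℤ.* + n ∎)
      where
      open ≡-Reasoning
      eq₁ : ∀ v u δ → v ≡ (v ℤ.- u ℤ.- δ) ℤ.+ u ℤ.+ δ
      eq₁ = ℤsolve
      eq₂ : ∀ x m q r n δ → q ℤ.* n ℤ.+ (x ℤ.+ m ℤ.+ r ℤ.* n) ℤ.+ δ ≡ x ℤ.+ (m ℤ.+ δ) ℤ.+ (r ℤ.+ q) ℤ.* n
      eq₂ = ℤsolve

    from : toℕ v ≋ x + pos d (i , j) [mod n ] → (+ n) ℤD.∣ (toℤ v ℤ.- toℤ u ℤ.- δ)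
    from (cong-mod r e) = ℤS.∣⇒∣ᵤ (ℤS.divides (r ℤ.- quot u≋) (begin
      toℤ v ℤ.- toℤ u ℤ.- δ ≡⟨ cong₂ (λ s t → s ℤ.- t ℤ.- δ) e (eqn u≋) ⟩
      + (x + pos d (i , j)) ℤ.+ r ℤ.* + n ℤ.- (+ (x + pos d (1 , 1)) ℤ.+ quot u≋ ℤ.* + n) ℤ.- δ
        ≡⟨ cong₂ (λ s t → s ℤ.+ r ℤ.* + n ℤ.- (t ℤ.+ quot u≋ ℤ.* + n) ℤ.- δ)
             (trans (ℤP.pos-+ x _) (cong (λ s → + x ℤ.+ s) (trans (+pos i j) δ≡)))
             (trans (ℤP.pos-+ x _) (cong (λ s → + x ℤ.+ s) (+pos 1 1))) ⟩
      + x ℤ.+ (+ 1 ℤ.+ + 1 ℤ.* + d ℤ.+ δ) ℤ.+ r ℤ.* + n ℤ.-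
          (+ x ℤ.+ (+ 1 ℤ.+ + 1 ℤ.* + d) ℤ.+ quot u≋ ℤ.* + n) ℤ.- δ
        ≡⟨ eq (+ x) (+ 1 ℤ.+ + 1 ℤ.* + d) r (quot u≋) (+ n) δ ⟩
      (r ℤ.- quot u≋) ℤ.* + n ∎))
      where
      open ≡-Reasoning
      eq : ∀ x m r q n δ → x ℤ.+ (m ℤ.+ δ) ℤ.+ r ℤ.* n ℤ.- (x ℤ.+ m ℤ.+ q ℤ.* n) ℤ.- δ ≡ (r ℤ.- q) ℤ.* n
      eq = ℤsolve

  module _ {v : Fin n} where

    private
      e⁺ : ∀ {m} → (+ n) ℤD.∣ (toℤ v ℤ.- toℤ u ℤ.+ + m) → (+ n) ℤD.∣ (toℤ v ℤ.- toℤ u ℤ.- (ℤ.- + m))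
      e⁺ {m} = subst (λ t → (+ n) ℤD.∣ (toℤ v ℤ.- toℤ u ℤ.+ t)) (sym (ℤP.neg-involutive (+ m)))
      e⁻ : ∀ {m} → (+ n) ℤD.∣ (toℤ v ℤ.- toℤ u ℤ.- (ℤ.- + m)) → (+ n) ℤD.∣ (toℤ v ℤ.- toℤ u ℤ.+ + m)
      e⁻ {m} = subst (λ t → (+ n) ℤD.∣ (toℤ v ℤ.- toℤ u ℤ.+ t)) (ℤP.neg-involutive (+ m))
      d∸1 : + (d ∸ 1) ≡ + d ℤ.- + 1
      d∸1 = sym (trans (ℤP.[+m]-[+n]≡m⊖n d 1) (ℤP.⊖-≥ d≥1))
      d+1 : + (d + 1) ≡ + d ℤ.+ + 1
      d+1 = ℤP.pos-+ d 1
      -- The displacement δ leads to the cell (i , j) with (i − 1) + (j − 1) d = δ.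
      s₁ : ∀ d → + 2 ℤ.+ + 1 ℤ.* d ≡ + 1 ℤ.+ + 1 ℤ.* d ℤ.+ + 1
      s₁ = ℤsolve
      s₂ : ∀ d → + 0 ℤ.+ + 1 ℤ.* d ≡ + 1 ℤ.+ + 1 ℤ.* d ℤ.+ ℤ.- + 1
      s₂ = ℤsolve
      s₃ : ∀ d → + 0 ℤ.+ + 2 ℤ.* d ≡ + 1 ℤ.+ + 1 ℤ.* d ℤ.+ (d ℤ.- + 1)
      s₃ = ℤsolve
      s₄ : ∀ d → + 2 ℤ.+ + 0 ℤ.* d ≡ + 1 ℤ.+ + 1 ℤ.* d ℤ.+ ℤ.- (d ℤ.- + 1)
      s₄ = ℤsolve
      s₅ : ∀ d → + 1 ℤ.+ + 2 ℤ.* d ≡ + 1 ℤ.+ + 1 ℤ.* d ℤ.+ d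
      s₅ = ℤsolve
      s₆ : ∀ d → + 1 ℤ.+ + 0 ℤ.* d ≡ + 1 ℤ.+ + 1 ℤ.* d ℤ.+ ℤ.- d
      s₆ = ℤsolve
      s₇ : ∀ d → + 2 ℤ.+ + 2 ℤ.* d ≡ + 1 ℤ.+ + 1 ℤ.* d ℤ.+ (d ℤ.+ + 1)
      s₇ = ℤsolve
      s₈ : ∀ d → + 0 ℤ.+ + 0 ℤ.* d ≡ + 1 ℤ.+ + 1 ℤ.* d ℤ.+ ℤ.- (d ℤ.+ + 1)
      s₈ = ℤsolve
      t₃ = trans (s₃ (+ d)) (cong (λ t → + 1 ℤ.+ + 1 ℤ.* + d ℤ.+ t) (sym d∸1))
      t₄ = trans (s₄ (+ d)) (cong (λ t → + 1 ℤ.+ + 1 ℤ.* + d ℤ.+ ℤ.- t) (sym d∸1))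
      t₇ = trans (s₇ (+ d)) (cong (λ t → + 1 ℤ.+ + 1 ℤ.* + d ℤ.+ t) (sym d+1))
      t₈ = trans (s₈ (+ d)) (cong (λ t → + 1 ℤ.+ + 1 ℤ.* + d ℤ.+ ℤ.- t) (sym d+1))

    InN⇒cell : InN n (circ d) u v → ∃[ k ] k ∈ grid3 × toℕ v ≋ x + pos d k [mod n ]
    InN⇒cell (inj₁ refl) = (1 , 1) , here refl , u≋
    InN⇒cell (inj₂ (_ , here (inj₁ h))) = (2 , 1) , ∈grid3 ≤-refl (s≤s z≤n) , to {v} 2 1 (+ 1) (s₁ (+ d)) h
    InN⇒cell (inj₂ (_ , here (inj₂ h))) = (0 , 1) , ∈grid3 z≤n (s≤s z≤n) , to {v} 0 1 (ℤ.- + 1) (s₂ (+ d))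
        (e⁺ {1} h)
    InN⇒cell (inj₂ (_ , there (here (inj₁ h)))) = (0 , 2) , ∈grid3 z≤n ≤-refl , to {v} 0 2 (+ (d ∸ 1)) t₃ h
    InN⇒cell (inj₂ (_ , there (here (inj₂ h)))) = (2 , 0) , ∈grid3 ≤-refl z≤n , to {v} 2 0 (ℤ.- + (d ∸ 1)) t₄
        (e⁺ {d ∸ 1} h)
    InN⇒cell (inj₂ (_ , there (there (here (inj₁ h))))) = (1 , 2) , ∈grid3 (s≤s z≤n) ≤-refl , to {v} 1 2
        (+ d) (s₅ (+ d)) h
    InN⇒cell (inj₂ (_ , there (there (here (inj₂ h))))) = (1 , 0) , ∈grid3 (s≤s z≤n) z≤n , to {v} 1 0
        (ℤ.- + d) (s₆ (+ d)) (e⁺ {d} h)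
    InN⇒cell (inj₂ (_ , there (there (there (here (inj₁ h)))))) = (2 , 2) , ∈grid3 ≤-refl ≤-refl , to {v} 2 2
        (+ (d + 1)) t₇ h
    InN⇒cell (inj₂ (_ , there (there (there (here (inj₂ h)))))) = (0 , 0) , ∈grid3 z≤n z≤n , to {v} 0 0
        (ℤ.- + (d + 1)) t₈ (e⁺ {d + 1} h)

    cell⇒InN : ∀ {k} → k ∈ grid3 → toℕ v ≋ x + pos d k [mod n ] → InN n (circ d) u v
    -- `Adj` demands distinct vertices, and nothing here prevents a rim cell from wrapping around to
    -- `u`, so equality is decided first.
    cell⇒InN {k} k∈ h with u ≟ᶠ v
    ... | yes u≡v = inj₁ u≡v
    ... | no u≢v = near k∈
      where
      near : k ∈ grid3 → InN n (circ d) u v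
      near (here refl) = inj₁ (≋⇒≡ (≋-trans u≋ (≋-sym h)))
      near (there (here refl)) = inj₂ (u≢v , there
          (there (there (here (inj₂ (e⁻ {d + 1} (from {v} 0 0 (ℤ.- + (d + 1)) t₈ h)))))))
      near (there (there (here refl))) = inj₂
          (u≢v , here (inj₂ (e⁻ {1} (from {v} 0 1 (ℤ.- + 1) (s₂ (+ d)) h))))
      near (there (there (there (here refl)))) = inj₂
          (u≢v , there (here (inj₁ (from {v} 0 2 (+ (d ∸ 1)) t₃ h))))
      near (there (there (there (there (here refl))))) = inj₂
          (u≢v , there (there (here (inj₂ (e⁻ {d} (from {v} 1 0 (ℤ.- + d) (s₆ (+ d)) h))))))
      near (there (there (there (there (there (here refl)))))) = inj₂
          (u≢v , there (there (here (inj₁ (from {v} 1 2 (+ d) (s₅ (+ d)) h)))))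
      near (there (there (there (there (there (there (here refl))))))) = inj₂
          (u≢v , there (here (inj₂ (e⁻ {d ∸ 1} (from {v} 2 0 (ℤ.- + (d ∸ 1)) t₄ h)))))
      near (there (there (there (there (there (there (there (here refl)))))))) = inj₂
          (u≢v , here (inj₁ (from {v} 2 1 (+ 1) (s₁ (+ d)) h)))
      near (there (there (there (there (there (there (there (there (here refl))))))))) = inj₂
          (u≢v , there (there (there (here (inj₁ (from {v} 2 2 (+ (d + 1)) t₇ h))))))

-- Windows embed faithfully in the cyclic group

module _ {n : ℕ} where

  ≋⇒≤⇒≡ : ∀ {x y} → x ≋ y [mod n ] → x < y + n → y < x + n → x ≡ y
  ≋⇒≤⇒≡ {x} {y} (cong-mod (+ zero) e) _ _ = trans (≋-nonneg {n} 0 e) (+-identityʳ y)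
  ≋⇒≤⇒≡ {x} {y} (cong-mod (+ suc q) e) x< _ =
    ⊥-elim (<⇒≱ x< (subst (y + n ≤_) (sym (≋-nonneg {n} (suc q) e)) (+-monoʳ-≤ y (m≤m+n n _))))
  ≋⇒≤⇒≡ {x} {y} h@(cong-mod -[1+ q ] e) _ y< =
    ⊥-elim (<⇒≱ y< (subst (x + n ≤_) (sym (≋-nonneg {n} (suc q) (eqn (≋-sym {n} {x} {y} h))))
        (+-monoʳ-≤ x (m≤m+n n _))))

  +n-≋ : ∀ x → x + n ≋ x [mod n ]
  +n-≋ x = cong-mod (+ 1) (trans (ℤP.pos-+ x n) (cong (λ s → + x ℤ.+ s) (sym (ℤP.*-identityˡ (+ n)))))

-- Neighbourhoods of vertices at most 2 apart in both directions consist of cells at most 4 apart.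
Close : Cell → Cell → Set
Close (i , j) (k , l) = (i ≤ 4 + k) × (k ≤ 4 + i) × (j ≤ 4 + l) × (l ≤ 4 + j)

-- A step in the second coordinate gains `d`, which exceeds the at most 4 lost in the first.
column-gap : ∀ {d i j k l} → 4 < d → i ≤ 4 + k → j < l → pos d (i , j) < pos d (k , l)
column-gap {d} {i} {j} {k} {l} 4<d i≤ j<l = begin-strict
  i + j * d       ≤⟨ +-monoˡ-≤ (j * d) i≤ ⟩
  4 + k + j * d   <⟨ +-monoˡ-< (j * d) (+-monoˡ-< k 4<d) ⟩
  d + k + j * d   ≡⟨ cong (_+ j * d) (+-comm d k) ⟩
  k + d + j * d   ≡⟨ +-assoc k d (j * d) ⟩
  k + suc j * d   ≤⟨ +-monoʳ-≤ k (*-monoˡ-≤ d j<l) ⟩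
  k + l * d       ∎
  where open ≤-Reasoning

pos-injective : ∀ {d} → 4 < d → ∀ {a c} → Close a c → pos d a ≡ pos d c → a ≡ c
pos-injective {d} 4<d {i , j} {k , l} (i≤ , k≤ , _) e with <-cmp j l
... | tri≈ _ refl _ = cong (_, j) (+-cancelʳ-≡ (j * d) i k e)
... | tri< j<l _ _  = ⊥-elim (<-irrefl e (column-gap 4<d i≤ j<l))
... | tri> _ _ l<j  = ⊥-elim (<-irrefl (sym e) (column-gap 4<d k≤ l<j))

-- Close cells lie at most 4 d + 4 < n apart, so congruence forces equal positions, and `4 < d`
-- recovers the coordinates.
faithful : ∀ {n d x} → 4 < d → 4 * d + 6 ≤ n → ∀ {a c} → Close a c → x + pos d a ≋ x + pos d c [mod n ] → a ≡
  c
faithful {n} {d} {x} 4<d n≥ {i , j} {k , l} close@(i≤ , k≤ , j≤ , l≤) h =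
  pos-injective 4<d close (+-cancelˡ-≡ x _ _ (≋⇒≤⇒≡ h (spread i≤ j≤) (spread k≤ l≤)))
  where
  spread : ∀ {i j k l} → i ≤ 4 + k → j ≤ 4 + l → x + pos d (i , j) < x + pos d (k , l) + n
  spread {i} {j} {k} {l} i≤ j≤ = begin-strict
    x + (i + j * d)               ≤⟨ +-monoʳ-≤ x (+-mono-≤ i≤ (*-monoˡ-≤ d j≤)) ⟩
    x + (4 + k + (4 + l) * d)     ≡⟨ eq x k l d ⟩
    x + (k + l * d) + (4 * d + 4) <⟨ +-monoʳ-< (x + (k + l * d))
        (<-≤-trans (+-monoʳ-< (4 * d) (s≤s (s≤s (s≤s (s≤s (s≤s z≤n)))))) n≥) ⟩
    x + (k + l * d) + n           ∎
    where
    open ≤-Reasoning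
    eq : ∀ x k l d → x + (4 + k + (4 + l) * d) ≡ x + (k + l * d) + (4 * d + 4)
    eq = solve-∀

-- Sums over a period

Σ< : ℕ → (ℕ → ℕ) → ℕ
Σ< zero    g = 0
Σ< (suc n) g = g 0 + Σ< n (g ∘ suc)

Σ-cong : ∀ n {g h} → (∀ {x} → x < n → g x ≡ h x) → Σ< n g ≡ Σ< n h
Σ-cong zero    e = refl
Σ-cong (suc n) e = cong₂ _+_ (e (s≤s z≤n)) (Σ-cong n (e ∘ s≤s))

Σ-mono : ∀ n {g h} → (∀ x → g x ≤ h x) → Σ< n g ≤ Σ< n h
Σ-mono zero    e = z≤n
Σ-mono (suc n) e = +-mono-≤ (e 0) (Σ-mono n (e ∘ suc))

Σ-+ : ∀ n g h → Σ< n (λ x → g x + h x) ≡ Σ< n g + Σ< n h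
Σ-+ zero    g h = refl
Σ-+ (suc n) g h rewrite Σ-+ n (g ∘ suc) (h ∘ suc) = eq (g 0) (h 0) _ _
  where
  eq : ∀ a b c d → a + b + (c + d) ≡ a + c + (b + d)
  eq = solve-∀

Σ-const : ∀ n k → Σ< n (λ _ → k) ≡ k * n
Σ-const zero    k = sym (*-zeroʳ k)
Σ-const (suc n) k = trans (cong (λ s → k + s) (Σ-const n k)) (sym (*-suc k n))

Σ-last : ∀ n g → Σ< (suc n) g ≡ Σ< n g + g n
Σ-last zero    g = +-comm (g 0) 0
Σ-last (suc n) g = trans (cong (λ s → g 0 + s) (Σ-last n (g ∘ suc))) (sym (+-assoc (g 0) _ _))

Σ-shift : ∀ n g → (∀ x → g (x + n) ≡ g x) → ∀ m → Σ< n (λ x → g (x + m)) ≡ Σ< n g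
Σ-shift n g per zero = Σ-cong n (λ {x} _ → cong g (+-identityʳ x))
Σ-shift n g per (suc m) = trans (Σ-cong n (λ {x} _ → cong g (+-suc x m))) (trans rotate (Σ-shift n g per m))
  where
  h : ℕ → ℕ
  h x = g (x + m)
  -- Both sides, increased by `h 0`, are the sum of the first n + 1 values, because `h n` equals
  -- `h 0`.
  rotate : Σ< n (h ∘ suc) ≡ Σ< n h
  rotate = +-cancelˡ-≡ (h 0) _ _ (trans (Σ-last n h) (trans (cong (λ s → Σ< n h + s)
    (trans (cong g (+-comm n m)) (per m))) (+-comm (Σ< n h) (h 0))))

Σ-sum : ∀ {A : Set} n (g : ℕ → A → ℕ) xs →
  Σ< n (λ x → sum (map (g x) xs)) ≡ sum (map (λ a → Σ< n (λ x → g x a)) xs)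
Σ-sum n g [] = Σ-const n 0
Σ-sum n g (a ∷ xs) = trans (Σ-+ n (λ x → g x a) _) (cong (λ s → Σ< n (λ x → g x a) + s) (Σ-sum n g xs))

indicator : Bool → ℕ
indicator b = if b then 1 else 0

∣∣≡Σ : ∀ {n} (C : Subset n) → ∣ C ∣ ≡ Σ< n (indicator ∘ look C)
∣∣≡Σ [] = refl
∣∣≡Σ (true ∷ C) = cong suc (∣∣≡Σ C)
∣∣≡Σ (false ∷ C) = ∣∣≡Σ C

sum-cong : ∀ {A : Set} {f g : A → ℕ} xs → (∀ {x} → x ∈ xs → f x ≡ g x) → sum (map f xs) ≡ sum (map g xs)
sum-cong [] e = refl
sum-cong (x ∷ xs) e = cong₂ _+_ (e (here refl)) (sum-cong xs (e ∘ there))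

∣∣≡Σcode : ∀ {n} .{{_ : NonZero n}} (C : Subset n) → ∣ C ∣ ≡ Σ< n (indicator ∘ code C)
∣∣≡Σcode {n} C = trans (∣∣≡Σ C) (Σ-cong n λ x<n → cong (indicator ∘ look C) (sym (m<n⇒m%n≡m x<n)))

pos-shift : ∀ d x a c → x + pos d (a +ᶜ c) ≡ x + pos d a + pos d c
pos-shift d x a c = trans (cong (λ s → x + s) (pos-+ d a c)) (sym (+-assoc x _ _))

-- `Neighbourhood` rebased at the corner `a` of a larger window, so that several vertices share one
-- base `x`.
module Visible {n d : ℕ} .{{_ : NonZero n}} (1≤d : 1 ≤ d) (C : Subset n) (x : ℕ) (a : Cell) {u : Fin n}
  (u≋ : toℕ u ≋ x + pos d (mid a) [mod n ]) where

  private
    u≋′ : toℕ u ≋ x + pos d a + pos d (1 , 1) [mod n ]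
    u≋′ = ≋-trans u≋ (≡⇒≋ (pos-shift d x a (1 , 1)))

  InI⇒cell : ∀ {c} → InI n (circ d) C u c →
    ∃[ k ] k ∈ grid3 × toℕ c ≋ x + pos d (a +ᶜ k) [mod n ] × code C (x + pos d (a +ᶜ k)) ≡ true
  InI⇒cell (nc , c∈) =
    let k , k∈ , c≋ = Neighbourhood.InN⇒cell 1≤d {x = x + pos d a} u≋′ nc
        c≋′ = ≋-trans c≋ (≡⇒≋ (sym (pos-shift d x a k)))
    in k , k∈ , c≋′ , code⁺ c≋′ c∈

  cell⇒InI : ∀ {c k} → k ∈ grid3 → toℕ c ≋ x + pos d (a +ᶜ k) [mod n ] → c ∈ₛ C → InI n (circ d) C u c
  cell⇒InI {c} {k} k∈ c≋ c∈ =
    Neighbourhood.cell⇒InN 1≤d {x = x + pos d a} u≋′ k∈ (≋-trans c≋ (≡⇒≋ (pos-shift d x a k))) , c∈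

-- The lower bound

module LowerBound {n d : ℕ} .{{_ : NonZero n}} (4<d : 4 < d) (n≥ : 4 * d + 6 ≤ n)
  {C : Subset n} (ld : LocatingDominating n (circ d) C) where

  private
    1≤d : 1 ≤ d
    1≤d = ≤-trans (s≤s z≤n) 4<d

  f : ℕ → Bool
  f = code C

  window : ℕ → Cell → Bool
  window x c = f (x + pos d c)

  dominated : ∀ x → ∃[ k ] k ∈ grid3 × window x k ≡ true
  dominated x =
    let c , Ic = proj₁ (proj₂ ld) (vertex (x + pos d (1 , 1)))
        k , k∈ , _ , e = Visible.InI⇒cell 1≤d C x (0 , 0) (vertex-≋ (x + pos d (1 , 1))) Ic
    in k , k∈ , e

  vertex∉ : ∀ {x} → f x ≡ false → vertex x ∉ₛ C
  vertex∉ {x} fx v∈ = case trans (sym (code⁺ (vertex-≋ x) v∈)) fx of λ ()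

  covers : ∀ y a b {c} → window y ⟨ a ⊆ b ⟩ →
    InI n (circ d) C (vertex (y + pos d (mid a))) c → InI n (circ d) C (vertex (y + pos d (mid b))) c
  covers y a b {c} a⊆b (nc , c∈) =
    let k , k∈ , c≋ , e = Visible.InI⇒cell 1≤d C y a (vertex-≋ (y + pos d (mid a))) (nc , c∈)
        k′ , k′∈ , eq = inBlock⁻ b (a +ᶜ k) (a⊆b k∈ e)
    in Visible.cell⇒InI 1≤d C y b (vertex-≋ (y + pos d (mid b))) k′∈
         (subst (λ t → toℕ c ≋ y + pos d t [mod n ]) eq c≋) c∈

  rim-close : ∀ {a b} → a ∈ rim → b ∈ rim → Close (mid a) (mid b)
  rim-close a∈ b∈ =
    let a₁ , a₂ = grid3-≤ (there a∈) ; b₁ , b₂ = grid3-≤ (there b∈)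
    in small a₁ , small b₁ , small a₂ , small b₂
    where
    small : ∀ {i k} → i ≤ 2 → i + 1 ≤ 4 + k
    small i≤2 = ≤-trans (+-monoˡ-≤ 1 i≤2) (m≤m+n 3 _)

  mid-injective : ∀ {a b} → mid a ≡ mid b → a ≡ b
  mid-injective {i , j} {k , l} e = cong₂ _,_ (+-cancelʳ-≡ 1 i k (cong proj₁ e))
      (+-cancelʳ-≡ 1 j l (cong proj₂ e))

  -- By `faithful` distinct rim cells give distinct vertices, to which the locating property
  -- applies.
  separated : ∀ y → Separated (window y)
  separated y {a} {b} a∈ b∈ a≢b fa fb a⊆b b⊆a = proj₂ (proj₂ ld) _ _ (vertex∉ fa) (vertex∉ fb)
    (λ e → a≢b (mid-injective (faithful {x = y} 4<d n≥ (rim-close a∈ b∈)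
      (≋-trans (≋-sym (vertex-≋ _)) (≋-trans (≡⇒≋ (cong toℕ e)) (vertex-≋ _))))))
    (λ c → mk⇔ (covers y a b a⊆b) (covers y b a b⊆a))

  pattern-at : ℕ → List Cell
  pattern-at x = pat (window x) (0 , 0)

  pat≡ : ∀ y a → pat (window y) a ≡ pattern-at (y + pos d a)
  pat≡ y a = filterᵇ-cong (All.tabulate {xs = grid3} λ {c} _ → cong f (pos-shift d y a c))

  pattern-periodic : ∀ x → pattern-at (x + n) ≡ pattern-at x
  pattern-periodic x = filterᵇ-cong (All.tabulate {xs = grid3} λ {c} _ → code-≋ C (≋-+ʳ (pos d c) (+n-≋ x)))

  -- Double counting: the block at `x`, in role `a`, is the block at `a` of the window based at `x`
  -- minus `pos d a`, and a cyclic shift does not change the sum.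
  reindex : (h : Cell → List Cell → ℕ) → Σ< n (λ x → sum (map (λ a → h a (pattern-at x)) grid3)) ≡
    Σ< n (λ y → sum (map (λ a → h a (pat (window y) a)) grid3))
  reindex h = trans (Σ-sum n (λ x a → h a (pattern-at x)) grid3) (trans
    (sum-cong grid3 λ {a} _ → trans
      (sym (Σ-shift n (λ x → h a (pattern-at x)) (λ x → cong (h a) (pattern-periodic x)) (pos d a)))
      (Σ-cong n λ {y} _ → cong (h a) (sym (pat≡ y a))))
    (sym (Σ-sum n (λ y a → h a (pat (window y) a)) grid3)))

  vertex-share : ∀ x → 4 + sum (map (λ a → σ (pattern-at x) (opp a)) grid3) ≤
    sum (map (λ a → α (pattern-at x) (opp a)) grid3)
  vertex-share x = let k , k∈ , e = dominated x in block-inequality (window x) (0 , 0) k∈ e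

  centre : ℕ → ℕ
  centre y = indicator (window y (2 , 2))

  share : ∀ y → Σα (window y) ≤ centre y * 20 + Σσ (window y)
  share y = by-centre (window y (2 , 2)) refl
    where
    by-centre : ∀ b → window y (2 , 2) ≡ b → Σα (window y) ≤ indicator b * 20 + Σσ (window y)
    by-centre true  e = codeword-share {window y} e (separated y)
    by-centre false e = ≤-trans (≤-reflexive
        (sum-cong {f = λ a → α (pat (window y) a) (opp a)} {g = λ _ → 0} grid3 λ a∈ → α≡0 {window y} a∈ e))
        z≤n

  -- `S` is the total refund, paid by vertices on one side and received by codewords on the other;
  -- it cancels.
  total : 4 * n ≤ ∣ C ∣ * 20
  total = +-cancelʳ-≤ S _ _ (begin
    4 * n + S ≡⟨ cong₂ _+_ (Σ-const n 4) (reindex (λ a js → σ js (opp a))) ⟨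
    Σ< n (λ _ → 4) + Σ< n (λ x → sum (map (λ a → σ (pattern-at x) (opp a)) grid3)) ≡⟨ Σ-+ n _ _ ⟨
    Σ< n (λ x → 4 + sum (map (λ a → σ (pattern-at x) (opp a)) grid3)) ≤⟨ Σ-mono n vertex-share ⟩
    Σ< n (λ x → sum (map (λ a → α (pattern-at x) (opp a)) grid3)) ≡⟨ reindex (λ a js → α js (opp a)) ⟩
    Σ< n (λ y → Σα (window y)) ≤⟨ Σ-mono n share ⟩
    Σ< n (λ y → centre y * 20 + Σσ (window y)) ≡⟨ Σ-+ n _ _ ⟩
    Σ< n (λ y → centre y * 20) + S ≡⟨ cong (_+ S) (trans (Σ-*20 n centre) (cong (_* 20) count)) ⟩
    ∣ C ∣ * 20 + S ∎)
    where
    open ≤-Reasoning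
    S : ℕ
    S = Σ< n (λ y → Σσ (window y))
    Σ-*20 : ∀ n g → Σ< n (λ y → g y * 20) ≡ Σ< n g * 20
    Σ-*20 zero g = refl
    Σ-*20 (suc n) g = trans (cong (λ s → g 0 * 20 + s) (Σ-*20 n (g ∘ suc))) (sym (*-distribʳ-+ 20 (g 0) _))
    count : Σ< n centre ≡ ∣ C ∣
    count = trans (Σ-shift n (indicator ∘ f)
      (λ x → cong indicator (code-≋ C (+n-≋ x))) (pos d (2 , 2)))
      (sym (∣∣≡Σcode C))

  n/5≤ : n / 5 ≤ ∣ C ∣
  n/5≤ = ≤-trans (/-monoˡ-≤ 5 n≤) (≤-reflexive (m*n/n≡m ∣ C ∣ 5))
    where
    n≤ : n ≤ ∣ C ∣ * 5
    n≤ = *-cancelˡ-≤ 4 (≤-trans total (≤-reflexive (eq ∣ C ∣)))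
      where
      eq : ∀ k → k * 20 ≡ 4 * (k * 5)
      eq = solve-∀

-- Decoding from 7×7 windows

difference : (Cell → Bool) → Cell → Cell → Bool
difference p a b = any (λ k → p (a +ᶜ k) ∧ not (inBlock b (a +ᶜ k))) grid3

-- In a 7×7 window around the vertex at (3 , 3), is it told apart from the vertex at mid a?  With the flag set,
-- only pairs of non-codewords have to be told apart.
resolved : Bool → (Cell → Bool) → Cell → Bool
resolved excused p a = ((a ≡ᶜ (2 , 2)) ∨ (excused ∧ (p (3 , 3) ∨ p (mid a)))) ∨
  (difference p (2 , 2) a ∨ difference p a (2 , 2))

-- Two vertices that share a codeword, at k in one block and at l in the other, differ by k − l, so the second
-- block has corner k +ᶜ opp l.
decodes : Bool → (Cell → Bool) → Bool
decodes excused p = any (λ k → p ((2 , 2) +ᶜ k)) grid3 ∧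
  all (λ k → all (λ l → resolved excused p (k +ᶜ opp l)) grid3) grid3

-- The windows `q` replace the code by explicit patterns. Agreement is asked for `i ≤ 6`, the extent
-- of a 7×7 window in the first coordinate.
module Decoding {n d : ℕ} .{{_ : NonZero n}} (4<d : 4 < d) (n≥ : 4 * d + 6 ≤ n) {C : Subset n}
  {excused : Bool}
  (q : ℕ → Cell → Bool) (q≡ : ∀ x {i j} → i ≤ 6 → code C (x + pos d (i , j)) ≡ q x (i , j))
  (decodable : ∀ x → decodes excused (q x) ≡ true) where

  private
    1≤d : 1 ≤ d
    1≤d = ≤-trans (s≤s z≤n) 4<d

  base : ∀ y c → ∃[ x ] y ≋ x + pos d c [mod n ]
  -- Going back by `pos d c` modulo n: adding the multiple `pos d c * n` first keeps the subtraction
  -- within ℕ.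
  base y c = y + (pos d c * n ∸ pos d c) , ≋-sym (cong-mod (+ pos d c) (trans (cong +_ (trans (+-assoc y _ _)
    (cong (λ s → y + s) (m∸n+n≡m (m≤m*n (pos d c) n)))))
        (trans (ℤP.pos-+ y _) (cong (λ s → + y ℤ.+ s) (ℤP.pos-* (pos d c) n)))))

  q⇒∈ : ∀ {w x i j} → i ≤ 6 → toℕ w ≋ x + pos d (i , j) [mod n ] → q x (i , j) ≡ true → w ∈ₛ C
  q⇒∈ {x = x} i≤6 w≋ e = code⁻ w≋ (trans (q≡ x i≤6) e)

  -- If `v` also sees the codeword found in block `a`, it sees it in some cell of block `b`; the two
  -- cells are close and congruent, hence equal, although the first lies outside block `b`.
  ¬difference : ∀ {x a b u v} → proj₁ a ≤ 4 →
    (∀ {k l} → k ∈ grid3 → l ∈ grid3 → Close (a +ᶜ k) (b +ᶜ l)) →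
    toℕ u ≋ x + pos d (mid a) [mod n ] → toℕ v ≋ x + pos d (mid b) [mod n ] →
    (∀ c → InI n (circ d) C u c → InI n (circ d) C v c) → difference (q x) a b ≡ true → ⊥
  ¬difference {x} {a} {b} {u} {v} a≤4 near u≋ v≋ same h =
    let k , k∈ , e = any-true⁻ (λ k → q x (a +ᶜ k) ∧ not (inBlock b (a +ᶜ k))) grid3 h
        qk , outside = ∧-true {q x (a +ᶜ k)} e
        c≋ = vertex-≋ (x + pos d (a +ᶜ k))
        Iu = Visible.cell⇒InI 1≤d C x a u≋ k∈ c≋ (q⇒∈ (+-mono-≤ a≤4 (proj₁ (grid3-≤ k∈))) c≋ qk)
        l , l∈ , c≋′ , _ = Visible.InI⇒cell 1≤d C x b v≋ (same (vertex (x + pos d (a +ᶜ k))) Iu)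
        k≡l = faithful {x = x} 4<d n≥ (near k∈ l∈) (≋-trans (≋-sym c≋) c≋′)
    in false≢true (trans (sym (cong not (trans (cong (inBlock b) k≡l) (inBlock-+ b l∈)))) outside)
    where
    false≢true : false ≡ true → ⊥
    false≢true ()

  dominating : Dominating n (circ d) C
  dominating u =
    let x , u≋ = base (toℕ u) (3 , 3)
        k , k∈ , e = any-true⁻ (λ k → q x ((2 , 2) +ᶜ k)) grid3 (proj₁ (∧-true (decodable x)))
        c≋ = vertex-≋ (x + pos d ((2 , 2) +ᶜ k))
    in vertex (x + pos d ((2 , 2) +ᶜ k)) ,
       Visible.cell⇒InI 1≤d C x (2 , 2) u≋ k∈ c≋
           (q⇒∈ (≤-trans (+-monoʳ-≤ 2 (proj₁ (grid3-≤ k∈))) (m≤m+n 4 2)) c≋ e)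

  private
    2≤4 : 2 ≤ 4
    2≤4 = s≤s (s≤s z≤n)
    -- Coordinates of the first cell lie between 2 and 4, those of the second between 0 and 6: never
    -- more than 4 apart.
    near₁ : ∀ {a} → proj₁ a ≤ 4 × proj₂ a ≤ 4 → ∀ {k l} → k ∈ grid3 → l ∈ grid3 → Close ((2 , 2) +ᶜ k)
        (a +ᶜ l)
    near₁ {a} (a₁ , a₂) {k} {l} k∈ l∈ =
      let k₁ , k₂ = grid3-≤ k∈ ; l₁ , l₂ = grid3-≤ l∈ in
      ≤-trans (+-monoʳ-≤ 2 k₁) (m≤m+n 4 _) , ≤-trans (+-mono-≤ a₁ l₁) (m≤m+n 6 (proj₁ k)) ,
      ≤-trans (+-monoʳ-≤ 2 k₂) (m≤m+n 4 _) , ≤-trans (+-mono-≤ a₂ l₂) (m≤m+n 6 (proj₂ k))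
    Close-sym : ∀ {a b} → Close a b → Close b a
    Close-sym (p , q , r , s) = q , p , s , r

  -- By domination `u` sees a codeword, and `v` sees it too if the sets agree. Its positions `k` and
  -- `l` in the two blocks place `v` in the window of `u`, where the finite check tells the vertices
  -- apart.
  separating : ∀ u v → (excused ≡ true → u ∉ₛ C × v ∉ₛ C) → u ≢ v → ¬ SameI n (circ d) C u v
  separating u v u∉,v∉ u≢v same =
    let x , u≋ = base (toℕ u) (3 , 3)
        z , v≋z = base (toℕ v) (1 , 1)
        c , Ic = dominating u
        k , k∈ , c≋ , _ = Visible.InI⇒cell 1≤d C x (2 , 2) u≋ Ic
        l , l∈ , c≋z , _ = Visible.InI⇒cell 1≤d C z (0 , 0) v≋z (Equivalence.to (same c) Ic)
        all-l = all-true (λ k → all (λ l → resolved excused (q x) (k +ᶜ opp l)) grid3) {grid3}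
            (proj₂ (∧-true {any (λ k → q x ((2 , 2) +ᶜ k)) grid3} (decodable x))) k∈
    in Offset.refute x z k l k∈ l∈ u≋ v≋z c≋ c≋z
         (∨-true (all-true (λ l → resolved excused (q x) (k +ᶜ opp l)) {grid3} all-l l∈))
    where
    module Offset (x z : ℕ) (k l : Cell) (k∈ : k ∈ grid3) (l∈ : l ∈ grid3)
      (u≋ : toℕ u ≋ x + pos d (3 , 3) [mod n ]) (v≋z : toℕ v ≋ z + pos d (1 , 1) [mod n ]) {c : Fin n}
      (c≋ : toℕ c ≋ x + pos d ((2 , 2) +ᶜ k) [mod n ]) (c≋z : toℕ c ≋ z + pos d l [mod n ]) where
      a : Cell
      a = k +ᶜ opp l
      a≤4 : proj₁ a ≤ 4 × proj₂ a ≤ 4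
      a≤4 = +-mono-≤ (proj₁ (grid3-≤ k∈)) (m∸n≤m 2 (proj₁ l)) , +-mono-≤ (proj₂ (grid3-≤ k∈))
          (m∸n≤m 2 (proj₂ l))
      -- Both sides carry an extra (1 , 1) because `l +ᶜ opp l` is (2 , 2); it is cancelled in `v≋`.
      z≋ : z + pos d (1 , 1) + pos d (1 , 1) ≋ x + pos d (mid a) + pos d (1 , 1) [mod n ]
      z≋ = ≋-trans (≡⇒≋ (trans (sym (pos-shift d z (1 , 1) (1 , 1)))
          (trans (cong (λ t → z + pos d t) (sym (All.lookup +opp l∈))) (pos-shift d z l (opp l)))))
        (≋-trans (≋-+ʳ (pos d (opp l)) (≋-trans (≋-sym c≋z) c≋))
          (≡⇒≋ (trans (sym (pos-shift d x ((2 , 2) +ᶜ k) (opp l)))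
              (trans (cong (λ t → x + pos d t) (rearrange k (opp l))) (pos-shift d x (mid a) (1 , 1))))))
        where
        rearrange : ∀ k l → ((2 , 2) +ᶜ k) +ᶜ l ≡ mid (k +ᶜ l) +ᶜ (1 , 1)
        rearrange (i , j) (k , l) = cong₂ _,_ (eq i k) (eq j l)
          where
          eq : ∀ i k → 2 + i + k ≡ i + k + 1 + 1
          eq = solve-∀
      v≋ : toℕ v ≋ x + pos d (mid a) [mod n ]
      v≋ = ≋-trans v≋z (+-cancelʳ-≋ _ z≋)
      refute : ((a ≡ᶜ (2 , 2)) ∨ (excused ∧ (q x (3 , 3) ∨ q x (mid a)))) ≡ true ⊎
        (difference (q x) (2 , 2) a ∨ difference (q x) a (2 , 2)) ≡ true → ⊥
      refute (inj₁ h) = [ same-vertex , (λ e → both-code (∧-true {excused} e)) ]′ (∨-true {a ≡ᶜ (2 , 2)} h)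
        where
        same-vertex : (a ≡ᶜ (2 , 2)) ≡ true → ⊥
        same-vertex e = u≢v (≋⇒≡ (≋-trans u≋ (≋-trans
          (≡⇒≋ (cong (λ t → x + pos d (mid t)) (sym (≡ᶜ⇒≡ a (2 , 2) e)))) (≋-sym v≋))))
        both-code : excused ≡ true × (q x (3 , 3) ∨ q x (mid a)) ≡ true → ⊥
        both-code (ex , e) = [ (λ e₁ → proj₁ (u∉,v∉ ex) (q⇒∈ {u} {x} (m≤m+n 3 3) u≋ e₁)) ,
          (λ e₂ → proj₂ (u∉,v∉ ex) (q⇒∈ {v} {x} (≤-trans (+-monoˡ-≤ 1 (proj₁ a≤4)) (m≤m+n 5 1)) v≋ e₂)) ]′
              (∨-true {q x (3 , 3)} e)
      refute (inj₂ h) =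
        [ ¬difference {x} {2 , 2} {a} 2≤4 (near₁ {a} a≤4) u≋ v≋ (λ c → Equivalence.to (same c))
        , ¬difference {x} {a} {2 , 2} (proj₁ a≤4) (λ k∈ l∈ → Close-sym (near₁ {a} a≤4 l∈ k∈)) v≋ u≋
            (λ c → Equivalence.from (same c))
        ]′ (∨-true {difference (q x) (2 , 2) a} h)

  nonempty : Nonempty C
  nonempty = let c , _ , c∈ = dominating (vertex 0) in c , c∈

-- Codes given by periodic predicates

look-tabulate : ∀ {n x} (g : ℕ → Bool) → x < n → look (Vec.tabulate {n = n} (g ∘ toℕ)) x ≡ g x
look-tabulate {suc n} {zero}  g _       = refl
look-tabulate {suc n} {suc x} g (s≤s h) = look-tabulate {n} (g ∘ suc) h

module Tabulated (n : ℕ) .{{_ : NonZero n}} (g : ℕ → Bool) (periodic : ∀ x → g (x % n) ≡ g x) where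

  tabulated : Subset n
  tabulated = Vec.tabulate (g ∘ toℕ)

  code-tabulated : ∀ x → code tabulated x ≡ g x
  code-tabulated x = trans (look-tabulate g (m%n<n x n)) (periodic x)

  ∣tabulated∣ : ∣ tabulated ∣ ≡ Σ< n (indicator ∘ g)
  ∣tabulated∣ = trans (∣∣≡Σ tabulated) (Σ-cong n λ h → cong indicator (look-tabulate g h))

Σ-split : ∀ a b g → Σ< (a + b) g ≡ Σ< a g + Σ< b (λ x → g (a + x))
Σ-split zero    b g = refl
Σ-split (suc a) b g = trans (cong (λ s → g 0 + s) (Σ-split a b (g ∘ suc))) (sym (+-assoc (g 0) _ _))

Σ-periodic : ∀ b g → (∀ x → g (b + x) ≡ g x) → ∀ t → Σ< (t * b) g ≡ t * Σ< b g
Σ-periodic b g per zero    = refl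
Σ-periodic b g per (suc t) = trans (Σ-split b (t * b) g)
  (cong (λ s → Σ< b g + s) (trans (Σ-cong (t * b) (λ {x} _ → per x)) (Σ-periodic b g per t)))

-- Only the residues of `x` and `d` modulo `b` matter, so a `b`-periodic pattern shows at most `b`
-- windows.
%-window : ∀ b .{{_ : NonZero b}} x i j d → (x + (i + j * d)) % b ≡ (x % b + (i + j * (d % b))) % b
%-window b x i j d = trans (cong (_% b) (trans
  (cong₂ (λ s t → s + (i + j * t)) (m≡m%n+[m/n]*n x b) (m≡m%n+[m/n]*n d b))
  (eq (x % b) (x / b) i j (d % b) (d / b) b)))
  ([m+kn]%n≡m%n _ (x / b + j * (d / b)) b)
  where
  eq : ∀ r s i j r′ s′ b → r + s * b + (i + j * (r′ + s′ * b)) ≡ r + (i + j * r′) + (s + j * s′) * b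
  eq = solve-∀

-- The locating-dominating code

residue : ℕ → Bool
residue r = (r ≡ᵇ 0) ∨ (r ≡ᵇ 4)

module TenPeriodic {n d : ℕ} .{{_ : NonZero n}} (4<d : 4 < d) (n≥ : 4 * d + 6 ≤ n) (d%10 : d % 10 ≡ 8)
  (n%10 : n % 10 ≡ 0) where

  g : ℕ → Bool
  g x = residue (x % 10)

  g-periodic : ∀ x → g (x % n) ≡ g x
  g-periodic x = cong residue (m∣n⇒o%n%m≡o%m 10 n x (ℕD.m%n≡0⇒n∣m n 10 n%10))

  open Tabulated n g g-periodic public

  sample : ℕ → Cell → Bool
  sample ρ (i , j) = residue ((ρ + (i + j * 8)) % 10)

  decodable : ∀ {ρ} → ρ < 10 → decodes true (sample ρ) ≡ true
  decodable h = all-true (decodes true ∘ sample) table (∈-upTo⁺ h)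
    where
    table : all (decodes true ∘ sample) (upTo 10) ≡ true
    table = refl

  window : ℕ → Cell → Bool
  window x = sample (x % 10)

  code≡window : ∀ x {i j} → i ≤ 6 → code tabulated (x + pos d (i , j)) ≡ window x (i , j)
  code≡window x {i} {j} _ = trans (code-tabulated (x + (i + j * d))) (cong residue
    (trans (%-window 10 x i j d) (cong (λ t → (x % 10 + (i + j * t)) % 10) d%10)))

  open Decoding 4<d n≥ {tabulated} {true} window code≡window (λ x → decodable (m%n<n x 10))

  locatingDominating : LocatingDominating n (circ d) tabulated
  locatingDominating = nonempty , dominating , λ u v u∉ v∉ → separating u v (λ _ → u∉ , v∉)

  size : ∣ tabulated ∣ ≡ n / 5
  size = begin
    ∣ tabulated ∣ ≡⟨ ∣tabulated∣ ⟩
    Σ< n (indicator ∘ g) ≡⟨ cong (λ s → Σ< s (indicator ∘ g)) n≡ ⟩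
    Σ< (n / 10 * 10) (indicator ∘ g) ≡⟨ Σ-periodic 10 (indicator ∘ g) periodic (n / 10) ⟩
    -- Each block of ten residues holds two codewords, 0 and 4.
    n / 10 * 2 ≡⟨ m*n/n≡m (n / 10 * 2) 5 ⟨
    n / 10 * 2 * 5 / 5 ≡⟨ cong (_/ 5) (trans (*-assoc (n / 10) 2 5) (sym n≡)) ⟩
    n / 5 ∎
    where
    open ≡-Reasoning
    periodic : ∀ x → indicator (g (10 + x)) ≡ indicator (g x)
    periodic x = cong (indicator ∘ residue) (trans (cong (_% 10) (+-comm 10 x)) ([m+n]%n≡m%n x 10))
    n≡ : n ≡ n / 10 * 10
    n≡ = trans (m≡m%n+[m/n]*n n 10) (cong (_+ n / 10 * 10) n%10)

part₁ : ∀ n d → d % 10 ≡ 8 → d ≥ 8 → n ≥ 4 * d + 6 → n % 10 ≡ 0 → γLD≡ n (circ d) (n / 5)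
part₁ n d d%10 d≥8 n≥ n%10 = (tabulated , locatingDominating , size) , λ C ld → LowerBound.n/5≤ 4<d n≥ ld
  where
  4<d : 4 < d
  4<d = ≤-trans (s≤s (s≤s (s≤s (s≤s (s≤s z≤n))))) d≥8
  instance
    n≢0 : NonZero n
    n≢0 = >-nonZero (≤-trans (s≤s z≤n) (≤-trans (m≤n+m 6 (4 * d)) n≥))
  open TenPeriodic {n} {d} 4<d n≥ d%10 n%10

-- The identifying codes

-- A king-grid identifying code of density 8/36, with period 6 in both directions.
site : Cell → Bool
site c = any (c ≡ᶜ_)
  ((2 , 0) ∷ (4 , 0) ∷ (0 , 1) ∷ (3 , 2) ∷ (1 , 3) ∷ (5 , 3) ∷ (3 , 4) ∷ (0 , 5) ∷ [])

-- The seam occupies the columns i with 6 ≤ Z + i < 12, and behind its left edge the row index is one higher.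
model : ℕ → ℕ → Cell → Bool
model Z κ (i , j) = ((6 ≤ᵇ Z + i) ∧ (Z + i <ᵇ 12)) ∨
  site ((Z + i) % 6 , (κ + j + indicator (6 ≤ᵇ Z + i)) % 6)

-- For Z < 6 the seam enters on the right, for 6 ≤ Z < 12 the window begins inside it, and for Z ≥
-- 12 it meets no seam.
model-decodes : ∀ {Z κ} → Z < 18 → κ < 6 → decodes false (model Z κ) ≡ true
model-decodes {Z} {κ} Z< κ< = all-true (λ κ → decodes false (model Z κ)) {upTo 6} {κ}
  (all-true (λ Z → all (λ κ → decodes false (model Z κ)) (upTo 6)) {upTo 18} {Z} table (∈-upTo⁺ Z<))
      (∈-upTo⁺ κ<)
  where
  table : all (λ Z → all (λ κ → decodes false (model Z κ)) (upTo 6)) (upTo 18) ≡ true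
  table = refl

<ᵇ-false : ∀ {m n} → n ≤ m → (m <ᵇ n) ≡ false
<ᵇ-false {m} {n} n≤m with m <ᵇ n in e
... | false = refl
... | true = ⊥-elim (≤⇒≯ n≤m (<ᵇ⇒< m n (isT e)))

<ᵇ-true : ∀ {m n} → m < n → (m <ᵇ n) ≡ true
<ᵇ-true h = ≡true (<⇒<ᵇ h)

%6-cong : ∀ {x y} → x ≋ y [mod 6 ] → x % 6 ≡ y % 6
%6-cong = ≋⇒%≡

-- A row consists of `m` periods. With `m ≥ 2` it has at least 12 columns, so seven consecutive
-- columns never meet two seams.
module Seam (m : ℕ) (m≥2 : 2 ≤ m) where

  d n : ℕ
  d = m * 6
  n = 6 * d

  12≤d : 12 ≤ d
  12≤d = *-monoˡ-≤ 6 m≥2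

  instance
    d≢0 : NonZero d
    d≢0 = >-nonZero (≤-trans (s≤s z≤n) 12≤d)
    n≢0 : NonZero n
    n≢0 = m*n≢0 6 d

  d≋0 : ∀ t → t * d ≋ 0 [mod 6 ]
  d≋0 t = cong-mod (+ (t * m)) (trans (cong +_ (sym (*-assoc t m 6)))
      (trans (ℤP.pos-* (t * m) 6) (sym (ℤP.+-identityˡ _))))

  g : ℕ → Bool
  g x = (x % d <ᵇ 6) ∨ site (x % 6 , (x / d) % 6)

  g-at : ∀ {s} t → s < d → g (s + t * d) ≡ (s <ᵇ 6) ∨ site (s % 6 , t % 6)
  g-at {s} t s<d = cong₂ (λ a b → (a <ᵇ 6) ∨ b) (trans ([m+kn]%n≡m%n s t d) (m<n⇒m%n≡m s<d))
    (cong₂ (λ a b → site (a , b % 6)) (%6-cong (≋-trans (≡⇒≋ (+-comm s (t * d))) (≋-+ʳ s (d≋0 t))))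
      (trans (+-distrib-/ s (t * d) (subst₂ (λ a b → a + b < d) (sym (m<n⇒m%n≡m s<d)) (sym (m*n%n≡0 t d))
          (subst (_< d) (sym (+-identityʳ s)) s<d)))
        (cong₂ _+_ (m<n⇒m/n≡0 s<d) (m*n/n≡m t d))))

  g-periodic : ∀ x → g (x % n) ≡ g x
  g-periodic x = cong₂ (λ a b → (a <ᵇ 6) ∨ b) (m∣n⇒o%n%m≡o%m d n x (ℕD.n∣m*n 6))
    (cong₂ (λ a b → site (a , b)) (m∣n⇒o%n%m≡o%m 6 n x (ℕD.m∣m*n d))
      (trans (cong (_% 6) (m%[n*o]/o≡m/o%n x 6 d)) (m%n%n≡m%n (x / d) 6)))

  open Tabulated n g g-periodic public

  Framed : ℕ → ℕ → ℕ → Set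
  Framed x Z κ = ∀ {i j} → i ≤ 6 → g (x + (i + j * d)) ≡ model Z κ (i , j)

  -- Either columns r to r + 6 stay within row `q`, or they run over its end into the next seam.
  frame : ∀ r q → r < d → ∃[ Z ] ∃[ κ ] Z < 18 × κ < 6 × Framed (r + q * d) Z κ
  frame r q r<d with r + 6 <? d
  -- This `Z` places the end of the row at model column 6, where the seam begins.
  ... | no r+6≮d = r + 6 ∸ d , q % 6 , ≤-trans Z<6 (m≤m+n 6 12) , m%n<n q 6 , λ {i} {j} i≤6 → right {i} {j}
      i≤6
    where
    Z : ℕ
    Z = r + 6 ∸ d
    Z+d : Z + d ≡ r + 6
    Z+d = m∸n+n≡m (≮⇒≥ r+6≮d)
    Z<6 : Z < 6
    Z<6 = +-cancelʳ-< d Z 6 (subst₂ _<_ (sym Z+d) (+-comm d 6) (+-monoˡ-< 6 r<d))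
    eqᵢ : ∀ i → Z + i + d ≡ r + i + 6
    eqᵢ i = trans (eq₁ Z i d) (trans (cong (_+ i) Z+d) (eq₁ r 6 i))
      where
      eq₁ : ∀ a b c → a + b + c ≡ a + c + b
      eq₁ = solve-∀
    right : ∀ {i j} → i ≤ 6 → g (r + q * d + (i + j * d)) ≡ model Z (q % 6) (i , j)
    right {i} {j} i≤6 with r + i <? d
    ... | yes r+i<d = begin
      g (r + q * d + (i + j * d)) ≡⟨ cong g (eq r q i j d) ⟩
      g (r + i + (q + j) * d) ≡⟨ g-at (q + j) r+i<d ⟩
      (r + i <ᵇ 6) ∨ site ((r + i) % 6 , (q + j) % 6)
        ≡⟨ cong₂ _∨_ (<ᵇ-false 6≤r+i) (cong₂ (λ a b → site (a , b)) (sym columns) (sym rows)) ⟩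
      site ((Z + i) % 6 , (q % 6 + j + 0) % 6)
        ≡⟨ cong (λ b → (b ∧ (Z + i <ᵇ 12)) ∨ site ((Z + i) % 6 , (q % 6 + j + indicator b) % 6))
            (sym (<ᵇ-false Z+i≤5)) ⟩
      model Z (q % 6) (i , j) ∎
      where
      open ≡-Reasoning
      eq : ∀ r q i j d → r + q * d + (i + j * d) ≡ r + i + (q + j) * d
      eq = solve-∀
      6≤r+i : 6 ≤ r + i
      6≤r+i = ≤-trans (+-cancelʳ-≤ 6 6 r (≤-trans 12≤d (≮⇒≥ r+6≮d))) (m≤m+n r i)
      Z+i≤5 : Z + i ≤ 5
      Z+i≤5 = ≤-pred (+-cancelʳ-< d (Z + i) 6 (subst₂ _<_ (sym (eqᵢ i)) (+-comm d 6) (+-monoˡ-< 6 r+i<d)))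
      columns : (Z + i) % 6 ≡ (r + i) % 6
      columns = %6-cong (≋-trans (≋-sym (≋-trans (≡⇒≋ (+-comm (Z + i) d))
          (≋-trans (≋-+ʳ (Z + i) (≋-trans (≡⇒≋ (sym (+-identityʳ d))) (d≋0 1))) ≋-refl)))
        (≋-trans (≡⇒≋ (eqᵢ i)) (+n-≋ (r + i))))
      rows : (q % 6 + j + 0) % 6 ≡ (q + j) % 6
      rows = %6-cong (≋-trans (≡⇒≋ (+-identityʳ (q % 6 + j))) (≋-+ʳ j (%-≋ q)))
    ... | no r+i≮d = begin
      g (r + q * d + (i + j * d)) ≡⟨ cong g
          (trans (eq r q i j d) (trans (cong (_+ (q + j) * d) (sym s+d)) (eq₂ s q j d))) ⟩
      g (s + suc (q + j) * d) ≡⟨ g-at (suc (q + j)) (≤-trans s<6 (≤-trans (m≤m+n 6 6) 12≤d)) ⟩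
      (s <ᵇ 6) ∨ site (s % 6 , suc (q + j) % 6) ≡⟨ cong (_∨ site (s % 6 , suc (q + j) % 6)) (<ᵇ-true s<6) ⟩
      -- Seam cells are codewords in both descriptions, whatever the row index.
      true ≡⟨ cong₂ (λ a b → (a ∧ b) ∨ site ((Z + i) % 6 , (q % 6 + j + indicator (6 ≤ᵇ Z + i)) % 6))
          (sym (≡true (≤⇒≤ᵇ 6≤Z+i))) (sym (<ᵇ-true Z+i<12)) ⟩
      model Z (q % 6) (i , j) ∎
      where
      open ≡-Reasoning
      s : ℕ
      s = r + i ∸ d
      s+d : s + d ≡ r + i
      s+d = m∸n+n≡m (≮⇒≥ r+i≮d)
      eq : ∀ r q i j d → r + q * d + (i + j * d) ≡ r + i + (q + j) * d
      eq = solve-∀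
      eq₂ : ∀ s q j d → s + d + (q + j) * d ≡ s + (d + (q + j) * d)
      eq₂ = solve-∀
      6≤Z+i : 6 ≤ Z + i
      6≤Z+i = +-cancelʳ-≤ d 6 (Z + i) (subst₂ _≤_ (+-comm d 6) (sym (eqᵢ i)) (+-monoˡ-≤ 6 (≮⇒≥ r+i≮d)))
      Z+i<12 : Z + i < 12
      Z+i<12 = +-mono-<-≤ Z<6 i≤6
      s<6 : s < 6
      s<6 = +-cancelʳ-< d s 6 (subst (_< 6 + d) (sym s+d)
          (subst (r + i <_) (+-comm d 6) (+-mono-<-≤ r<d i≤6)))
  -- Since `Z ≥ 6`, the model adds 1 to every row index; `q + 5` compensates modulo 6.
  ... | yes r+6<d = Z , (q + 5) % 6 , Z<18 , m%n<n (q + 5) 6 , λ {i} {j} i≤6 → begin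
      g (r + q * d + (i + j * d)) ≡⟨ cong g (eq r q i j d) ⟩
      g (r + i + (q + j) * d) ≡⟨ g-at (q + j) (≤-<-trans (+-monoʳ-≤ r i≤6) r+6<d) ⟩
      (r + i <ᵇ 6) ∨ site ((r + i) % 6 , (q + j) % 6)
        ≡⟨ cong₂ _∨_ (sym (seam i)) (cong₂ (λ a b → site (a , b)) (sym (columns i)) (sym (rows i j))) ⟩
      model Z ((q + 5) % 6) (i , j) ∎
    where
    open ≡-Reasoning
    eq : ∀ r q i j d → r + q * d + (i + j * d) ≡ r + i + (q + j) * d
    eq = solve-∀
    -- Inside the seam the exact column is kept; beyond it only the residue modulo 6, moved to 6 or
    -- above so that no seam column appears.
    choice : ∃[ z ] z < 12 × z % 6 ≡ r % 6 × (∀ i → (z + i <ᵇ 6) ≡ (r + i <ᵇ 6))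
    choice with r <? 6
    ... | yes r<6 = r , ≤-trans r<6 (m≤m+n 6 6) , refl , λ _ → refl
    ... | no r≮6 = 6 + r % 6 , +-monoʳ-< 6 (m%n<n r 6) ,
      %6-cong (≋-trans (≡⇒≋ (+-comm 6 (r % 6))) (≋-trans (+n-≋ (r % 6)) (%-≋ r))) ,
      λ i → sym (<ᵇ-false (≤-trans (≮⇒≥ r≮6) (m≤m+n r i)))
    z : ℕ
    z = proj₁ choice
    Z : ℕ
    Z = 6 + z
    Z<18 : Z < 18
    Z<18 = +-monoʳ-< 6 (proj₁ (proj₂ choice))
    seam : ∀ i → ((6 ≤ᵇ Z + i) ∧ (Z + i <ᵇ 12)) ≡ (r + i <ᵇ 6)
    seam = proj₂ (proj₂ (proj₂ choice))
    columns : ∀ i → (Z + i) % 6 ≡ (r + i) % 6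
    columns i = %6-cong (≋-+ʳ i (≋-trans (≡⇒≋ (+-comm 6 z)) (≋-trans (+n-≋ z)
      (≋-trans (≋-sym (%-≋ z)) (≋-trans (≡⇒≋ (proj₁ (proj₂ (proj₂ choice)))) (%-≋ r))))))
    rows : ∀ i j → ((q + 5) % 6 + j + indicator (6 ≤ᵇ Z + i)) % 6 ≡ (q + j) % 6
    rows i j = %6-cong (≋-trans (≋-+ʳ 1 (≋-+ʳ j (%-≋ (q + 5)))) (≋-trans (≡⇒≋ (eq₆ q j)) (+n-≋ (q + j))))
      where
      eq₆ : ∀ q j → q + 5 + j + 1 ≡ q + j + 6
      eq₆ = solve-∀

  -- Kept opaque so that `window` does not unfold the case analysis of `frame`.
  abstract
    framed : ∀ x → ∃[ Z ] ∃[ κ ] Z < 18 × κ < 6 × Framed x Z κ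
    framed x with frame (x % d) (x / d) (m%n<n x d)
    ... | Z , κ , Z< , κ< , h = Z , κ , Z< , κ< , λ {i} {j} i≤6 →
      trans (cong (λ y → g (y + (i + j * d))) (m≡m%n+[m/n]*n x d)) (h {i} {j} i≤6)

  4<d : 4 < d
  4<d = ≤-trans (m≤m+n 5 7) 12≤d

  n≥ : 4 * d + 6 ≤ n
  n≥ = subst (4 * d + 6 ≤_) (sym (*-distribʳ-+ d 4 2))
      (+-monoʳ-≤ (4 * d) (≤-trans (m≤m+n 6 6) (≤-trans 12≤d (m≤m+n d _))))

  window : ℕ → Cell → Bool
  window x = model (proj₁ (framed x)) (proj₁ (proj₂ (framed x)))

  code≡window : ∀ x {i j} → i ≤ 6 → code tabulated (x + pos d (i , j)) ≡ window x (i , j)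
  code≡window x {i} {j} i≤6 = trans (code-tabulated (x + (i + j * d)))
    (proj₂ (proj₂ (proj₂ (proj₂ (framed x)))) {i} {j} i≤6)

  window-decodes : ∀ x → decodes false (window x) ≡ true
  window-decodes x = model-decodes {proj₁ (framed x)} {proj₁ (proj₂ (framed x))}
    (proj₁ (proj₂ (proj₂ (framed x)))) (proj₁ (proj₂ (proj₂ (proj₂ (framed x)))))

  open Decoding 4<d n≥ {tabulated} {false} window code≡window window-decodes

  identifying : Identifying n (circ d) tabulated
  identifying = nonempty , dominating , λ u v → separating u v λ ()

-- Size and limiting density of the identifying codes

Σ-blocks : ∀ t b g → Σ< (t * b) g ≡ Σ< t (λ q → Σ< b (λ r → g (r + q * b)))
Σ-blocks zero    b g = refl
Σ-blocks (suc t) b g = trans (Σ-split b (t * b) g) (cong₂ _+_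
  (Σ-cong b λ {r} _ → cong g (sym (+-identityʳ r)))
  (trans (Σ-blocks t b (g ∘ (λ x → b + x))) (Σ-cong t λ {q} _ → Σ-cong b λ {r} _ → cong g (eq b r (q * b)))))
  where
  eq : ∀ b r s → b + (r + s) ≡ r + (b + s)
  eq = solve-∀

module _ (k : ℕ) where
  open Seam (2 + k) (m≤m+n 2 k)

  -- Each of the 6 rows has 6 seam codewords and 1 + k further periods; the rows of `site` hold 2,
  -- 1, 1, 2, 1, 1 codewords, 8 in all.
  seam-size : ∣ tabulated ∣ ≡ 28 + 8 * (2 + k)
  seam-size = begin
    ∣ tabulated ∣ ≡⟨ ∣tabulated∣ ⟩
    Σ< (6 * d) (indicator ∘ g) ≡⟨ Σ-blocks 6 d (indicator ∘ g) ⟩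
    Σ< 6 (λ q → Σ< d (λ r → indicator (g (r + q * d)))) ≡⟨ Σ-cong 6 (λ {q} _ → row q) ⟩
    Σ< 6 (λ q → 6 + suc k * sites q) ≡⟨ eq (suc k) ⟩
    28 + 8 * (2 + k) ∎
    where
    open ≡-Reasoning
    sites : ℕ → ℕ
    sites q = Σ< 6 (λ r → indicator (site ((6 + r) % 6 , q % 6)))
    row : ∀ q → Σ< d (λ r → indicator (g (r + q * d))) ≡ 6 + suc k * sites q
    row q = begin
      Σ< d (λ r → indicator (g (r + q * d)))
        ≡⟨ Σ-cong d (λ r<d → cong indicator (g-at q r<d)) ⟩
      Σ< (6 + suc k * 6) (λ r → indicator ((r <ᵇ 6) ∨ site (r % 6 , q % 6)))
        ≡⟨ Σ-split 6 (suc k * 6) (λ r → indicator ((r <ᵇ 6) ∨ site (r % 6 , q % 6))) ⟩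
      6 + Σ< (suc k * 6) (λ r → indicator (site ((6 + r) % 6 , q % 6)))
        ≡⟨ cong (λ s → 6 + s) (Σ-periodic 6 (λ r → indicator (site ((6 + r) % 6 , q % 6)))
          (λ x → cong (λ t → indicator (site (t , q % 6)))
              (%6-cong (≋-trans (≡⇒≋ (+-comm 6 (6 + x))) (+n-≋ (6 + x))))) (suc k)) ⟩
      6 + suc k * sites q ∎
    eq : ∀ t → 6 + t * 2 + (6 + t * 1 + (6 + t * 1 + (6 + t * 2 + (6 + t * 1 + (6 + t * 1 + 0))))) ≡ 28 + 8 *
        (1 + t)
    eq = solve-∀

-- The hypothesis is the identity with denominators cleared; passing to unnormalised rationals
-- avoids reduction to lowest terms.
excess : ∀ a n b .{{_ : NonZero n}} .{{_ : NonZero b}} →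
  (+ a ℤ.* + 9 ℤ.+ ℤ.- + 2 ℤ.* + n) ℤ.* + b ≡ + 7 ℤ.* (+ n ℤ.* + 9) →
  frac a n ℚ.- ((+ 2) ℚ./ 9) ≡ (+ 7) ℚ./ b
excess a (suc n) (suc b) e = ℚP.toℚᵘ-injective (begin
  ℚ.toℚᵘ (frac a (suc n) ℚ.- ((+ 2) ℚ./ 9))
    ≈⟨ ℚP.toℚᵘ-homo-+ (frac a (suc n)) (ℚ.- ((+ 2) ℚ./ 9)) ⟩
  ℚ.toℚᵘ (frac a (suc n)) ℚᵘ.+ mkℚᵘ (ℤ.- + 2) 8
    ≈⟨ ℚᵘP.+-congˡ (mkℚᵘ (ℤ.- + 2) 8) (ℚP.toℚᵘ-fromℚᵘ (mkℚᵘ (+ a) n)) ⟩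
  mkℚᵘ (+ a) n ℚᵘ.+ mkℚᵘ (ℤ.- + 2) 8
    ≈⟨ ℚᵘ.*≡* (trans e (cong (λ t → + 7 ℤ.* t) (sym (ℤP.pos-* (suc n) 9)))) ⟩
  mkℚᵘ (+ 7) b
    ≈⟨ ℚᵘP.≃-sym (ℚP.toℚᵘ-fromℚᵘ (mkℚᵘ (+ 7) b)) ⟩
  ℚ.toℚᵘ ((+ 7) ℚ./ suc b) ∎)
  where open ℚᵘP.≃-Reasoning

-- A positive ε with denominator D is at least 1 / D, so `7 * D < b` suffices.
seven-over-small : ∀ ε → ℚ.0ℚ ℚ.< ε → ∃[ D ] ∀ b .{{_ : NonZero b}} → 7 * D < b → ℚ.∣ (+ 7) ℚ./ b ∣ ℚ.< ε
seven-over-small (mkℚ (+ zero) _ _) (ℚ.*<* (ℤ.+<+ ()))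
seven-over-small (mkℚ -[1+ _ ] _ _) (ℚ.*<* ())
seven-over-small (mkℚ (+ suc e) δ _) _ = suc δ , λ where
  (suc b) 7δ<b → subst (ℚ._< _)
    (sym (ℚP.0≤p⇒∣p∣≡p (ℚP.nonNegative⁻¹ ((+ 7) ℚ./ suc b) {{ℚP.normalize-nonNeg 7 (suc b)}})))
    (ℚP.toℚᵘ-cancel-< (ℚᵘP.<-respˡ-≃ (ℚᵘP.≃-sym (ℚP.toℚᵘ-fromℚᵘ (mkℚᵘ (+ 7) b)))
      (ℚᵘ.*<* (subst₂ ℤ._<_ (ℤP.pos-* 7 (suc δ)) (ℤP.pos-* (suc e) (suc b))
        (ℤ.+<+ (<-≤-trans 7δ<b (m≤m+n (suc b) (e * suc b))))))))

-- The main terms cancel, as 8 m / (36 m) = 2 / 9; what remains is 28 / (36 m).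
seam-excess : ∀ m .{{_ : NonZero m}} .{{_ : NonZero (6 * (m * 6))}} .{{_ : NonZero (9 * m)}} →
  frac (28 + 8 * m) (6 * (m * 6)) ℚ.- ((+ 2) ℚ./ 9) ≡ (+ 7) ℚ./ (9 * m)
seam-excess m = excess (28 + 8 * m) (6 * (m * 6)) (9 * m) (begin
  (+ (28 + 8 * m) ℤ.* + 9 ℤ.+ ℤ.- + 2 ℤ.* + (6 * (m * 6))) ℤ.* + (9 * m)
    ≡⟨ cong₂ ℤ._*_ (cong₂ (λ s t → s ℤ.* + 9 ℤ.+ ℤ.- + 2 ℤ.* t)
        (trans (ℤP.pos-+ 28 (8 * m)) (cong (λ s → + 28 ℤ.+ s) (ℤP.pos-* 8 m))) n≡) (ℤP.pos-* 9 m) ⟩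
  ((+ 28 ℤ.+ + 8 ℤ.* + m) ℤ.* + 9 ℤ.+ ℤ.- + 2 ℤ.* (+ 6 ℤ.* (+ m ℤ.* + 6))) ℤ.* (+ 9 ℤ.* + m)
    ≡⟨ eq (+ m) ⟩
  + 7 ℤ.* ((+ 6 ℤ.* (+ m ℤ.* + 6)) ℤ.* + 9)
    ≡⟨ cong (λ t → + 7 ℤ.* (t ℤ.* + 9)) (sym n≡) ⟩
  + 7 ℤ.* (+ (6 * (m * 6)) ℤ.* + 9) ∎)
  where
  open ≡-Reasoning
  n≡ : + (6 * (m * 6)) ≡ + 6 ℤ.* (+ m ℤ.* + 6)
  n≡ = trans (ℤP.pos-* 6 (m * 6)) (cong (λ t → + 6 ℤ.* t) (ℤP.pos-* m 6))
  eq : ∀ m → ((+ 28 ℤ.+ + 8 ℤ.* m) ℤ.* + 9 ℤ.+ ℤ.- + 2 ℤ.* (+ 6 ℤ.* (m ℤ.* + 6))) ℤ.* (+ 9 ℤ.* m) ≡ + 7 ℤ.*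
      ((+ 6 ℤ.* (m ℤ.* + 6)) ℤ.* + 9)
  eq = ℤsolve

theorem6 : (∀ (n d : ℕ) → d % 10 ≡ 8 → d ≥ 8 → n ≥ 4 * d + 6 → n % 10 ≡ 0 →
    γLD≡ n (1 ∷ (d ∸ 1) ∷ d ∷ (d + 1) ∷ []) (n / 5))
    ×
    (Σ (ℕ → ℕ) λ nₖ → Σ (ℕ → ℕ) λ dₖ → Σ ((k : ℕ) → Subset (nₖ k)) λ Cₖ →
    ((∀ (k : ℕ) → dₖ k ≥ 3 × 2 * (dₖ k + 1) ≤ nₖ k
    × Identifying (nₖ k) (1 ∷ (dₖ k ∸ 1) ∷ dₖ k ∷ (dₖ k + 1) ∷ []) (Cₖ k))
    × (∀ (ε : ℚ) → ℚ.0ℚ ℚ.< ε → ∃[ K ] ∀ (k : ℕ) → k ≥ K →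
    ℚ.∣ frac (∣ Cₖ k ∣) (nₖ k) ℚ.- ((+ 2) ℚ./ 9) ∣ ℚ.< ε)))
theorem6 = part₁ ,
  -- The k-th code has 2 + k periods per row, to meet the requirement `m ≥ 2`.
  (λ k → Seam.n (2 + k) (2≤ k)) , (λ k → Seam.d (2 + k) (2≤ k)) , (λ k → Seam.tabulated (2 + k) (2≤ k)) ,
  (λ k → ≤-trans (m≤m+n 3 2) (Seam.4<d (2 + k) (2≤ k)) , d≤n/2 k , Seam.identifying (2 + k) (2≤ k)) ,
  λ ε 0<ε → let D , below = seven-over-small ε 0<ε in D , λ k k≥D →
    subst (λ x → ℚ.∣ x ∣ ℚ.< ε)
      (sym (trans (cong (λ s → frac s (Seam.n (2 + k) (2≤ k)) ℚ.- ((+ 2) ℚ./ 9)) (seam-size k)) (seam-excess (2 + k))))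
      (below (9 * (2 + k)) (large k≥D))
  where
  2≤ : ∀ k → 2 ≤ 2 + k
  2≤ k = m≤m+n 2 k
  large : ∀ {D k} → D ≤ k → 7 * D < 9 * (2 + k)
  large {D} {k} D≤k = <-≤-trans (s≤s (*-monoʳ-≤ 7 D≤k)) (≤-trans (≤-reflexive (sym (+-comm (7 * k) 1))) (subst (7 * k + 1 ≤_) (eq k) (+-monoʳ-≤ (7 * k) (m≤m+n 1 (17 + 2 * k)))))
    where
    eq : ∀ k → 7 * k + (18 + 2 * k) ≡ 9 * (2 + k)
    eq = solve-∀
  d≤n/2 : ∀ k → 2 * (Seam.d (2 + k) (2≤ k) + 1) ≤ Seam.n (2 + k) (2≤ k)
  d≤n/2 k = subst₂ _≤_ (eq₁ d) (eq₂ d) (+-monoʳ-≤ (2 * d) (≤-trans (≤-trans (m≤m+n 2 3) (Seam.4<d (2 + k) (2≤ k))) (m≤m+n d (3 * d))))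
    where
    d : ℕ
    d = Seam.d (2 + k) (2≤ k)
    eq₁ : ∀ d → 2 * d + 2 ≡ 2 * (d + 1)
    eq₁ = solve-∀
    eq₂ : ∀ d → 2 * d + (d + 3 * d) ≡ 6 * d
    eq₂ = solve-∀
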